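{- Let $d > 1$ be an integer and let $K = \operatorname{Frac}(\mathcal{O})$ be the field of fractions of a complete discrete valuation ring $\mathcal{O}$ whose residue field is finite. In the coefficient-choosing game of degree $d$ over $K$, whichever player makes the last move has a winning strategy.
   Context: The coefficient-choosing game of degree $d$ over a commutative ring $R$ with unity: Nora and Wanda alternately choose coefficients of $f(x) = a_d x^d + \cdots + a_0$; on each move the current player picks a not-yet-chosen coefficient and assigns it a value in $R$, subject to $a_d \neq 0$, $a_0 \neq 0$. After all $d+1$ coefficients are chosen, Wanda wins if $f$ has a root in $\operatorname{Frac}(R)$ (here $R = K$ is a field, so a root in $K$), and Nora wins otherwise. Who moves first is fixed in advance, which determines who makes the last move. -}

module Defs where

open import Level using (Level; _⊔_; 0ℓ) renaming (suc to lsuc)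
open import Algebra.Bundles using (CommutativeRing)
open import Algebra.Definitions using (Invertible)
open import Algebra.Morphism.Structures using (IsRingMonomorphism)
open import Data.Fin.Base using (Fin; zero; fromℕ; toℕ)
open import Data.Integer.Base as ℤ using (ℤ; 0ℤ; 1ℤ)
open import Data.Maybe.Base using (Maybe; just; nothing)
open import Data.Nat.Base as ℕ using (ℕ; zero; suc)
open import Data.Product.Base using (Σ; ∃; ∃-syntax; _×_; _,_)
open import Data.Sum.Base using (_⊎_; inj₁; inj₂)
open import Data.Vec.Base using (Vec; lookup; map; replicate; _[_]≔_)
open import Function.Bundles using (_⇔_; Bijection; Equivalence)
open import Relation.Binary.Bundles using (Setoid)
open import Relation.Binary.PropositionalEquality as ≡ using (_≡_; _≢_)
open import Relation.Binary.Construct.Add.Supremum.NonStrict ℤ._≤_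
  using (_≤⁺_; [_]; _≤⊤⁺; ≤⁺-trans; ≤⁺-reflexive-≡)
open import Relation.Nullary.Construct.Add.Supremum using (_⁺; [_]; ⊤⁺)
open import Relation.Nullary.Negation using (¬_)

import Algebra.Properties.CommutativeMonoid.Sum as Sum
import Algebra.Properties.Ring as RingProperties
import Algebra.Properties.Semiring.Exp as Exp
import Data.Integer.Properties as ℤ
import Relation.Binary.Reasoning.Setoid as SetoidReasoning

------------------------------------------------------------------------
-- Fields and fields of fractions

record Field (c ℓ : Level) : Set (lsuc (c ⊔ ℓ)) where
  field
    commutativeRing : CommutativeRing c ℓ
  open CommutativeRing commutativeRing public
  field
    1≉0     : ¬ 1# ≈ 0#
    inverse : ∀ x → ¬ x ≈ 0# → Invertible _≈_ 1# _*_ x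

-- The existence of an injective homomorphism into a field makes O an
-- integral domain.
record IsFractionField {c ℓ c′ ℓ′ : Level}
  (O : CommutativeRing c ℓ) (K : Field c′ ℓ′)
  (ι : CommutativeRing.Carrier O → Field.Carrier K)
  : Set (c ⊔ ℓ ⊔ c′ ⊔ ℓ′) where
  private
    module O = CommutativeRing O
    module K = Field K
  field
    isRingMonomorphism : IsRingMonomorphism O.rawRing K.rawRing ι
    fraction : ∀ z → ∃[ a ] ∃[ b ] (¬ b O.≈ O.0#) × (z K.* ι b K.≈ ι a)
  open IsRingMonomorphism isRingMonomorphism public

------------------------------------------------------------------------
-- Discrete valuations, with v 0 = ∞ (written ⊤⁺)

infixl 6 _+∞_
infixl 7 _⊓∞_

_+∞_ : ℤ ⁺ → ℤ ⁺ → ℤ ⁺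
⊤⁺    +∞ _     = ⊤⁺
[ _ ] +∞ ⊤⁺    = ⊤⁺
[ m ] +∞ [ n ] = [ m ℤ.+ n ]

_⊓∞_ : ℤ ⁺ → ℤ ⁺ → ℤ ⁺
⊤⁺    ⊓∞ y     = y
[ m ] ⊓∞ ⊤⁺    = [ m ]
[ m ] ⊓∞ [ n ] = [ m ℤ.⊓ n ]

record DiscreteValuation {c ℓ : Level} (K : Field c ℓ) : Set (c ⊔ ℓ) where
  open Field K
  field
    v            : Carrier → ℤ ⁺
    v-cong       : ∀ {x y} → x ≈ y → v x ≡ v y
    v-∞          : ∀ x → v x ≡ ⊤⁺ ⇔ x ≈ 0#
    v-*          : ∀ x y → v (x * y) ≡ v x +∞ v y
    v-+          : ∀ x y → v x ⊓∞ v y ≤⁺ v (x + y)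
    v-surjective : ∀ n → ∃[ x ] v x ≡ [ n ]

-- O is a discrete valuation ring when it is the valuation ring
-- { z ∈ K | v z ≥ 0 } of some discrete valuation of its fraction field.
record IsDiscreteValuationRing {c ℓ c′ ℓ′ : Level}
  {O : CommutativeRing c ℓ} {K : Field c′ ℓ′}
  {ι : CommutativeRing.Carrier O → Field.Carrier K}
  (frac : IsFractionField O K ι) : Set (c ⊔ ℓ ⊔ c′ ⊔ ℓ′) where
  private
    module O = CommutativeRing O
    module K = Field K
  field
    discreteValuation : DiscreteValuation K
  open DiscreteValuation discreteValuation public
  field
    integral : ∀ z → [ 0ℤ ] ≤⁺ v z ⇔ (∃[ a ] ι a K.≈ z)

------------------------------------------------------------------------
-- Completeness and the residue field

module _ {c ℓ c′ ℓ′ : Level}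
  {O : CommutativeRing c ℓ} {K : Field c′ ℓ′}
  {ι : CommutativeRing.Carrier O → Field.Carrier K}
  {frac : IsFractionField O K ι}
  (dvr : IsDiscreteValuationRing frac) where

  private
    module O = CommutativeRing O
    module K = Field K
    module F = IsFractionField frac
    open IsDiscreteValuationRing dvr

  -- x ≡ y modulo 𝔪ⁿ, where 𝔪 = { a ∈ O | v a > 0 } is the maximal ideal.
  CongruentMod : ℕ → O.Carrier → O.Carrier → Set
  CongruentMod n x y = [ ℤ.+ n ] ≤⁺ v (ι (x O.- y))

  IsCauchy : (ℕ → O.Carrier) → Set
  IsCauchy s = ∀ n → ∃[ N ] ∀ i j → N ℕ.≤ i → N ℕ.≤ j → CongruentMod n (s i) (s j)

  ConvergesTo : (ℕ → O.Carrier) → O.Carrier → Set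
  ConvergesTo s a = ∀ n → ∃[ N ] ∀ i → N ℕ.≤ i → CongruentMod n (s i) a

  IsComplete : Set c
  IsComplete = ∀ s → IsCauchy s → ∃[ a ] ConvergesTo s a

  private
    ≤-⊓∞ : ∀ {k} x y → k ≤⁺ x → k ≤⁺ y → k ≤⁺ x ⊓∞ y
    ≤-⊓∞ ⊤⁺    y     p     q     = q
    ≤-⊓∞ [ m ] ⊤⁺    p     q     = p
    ≤-⊓∞ [ m ] [ n ] [ p ] [ q ] = [ ℤ.⊓-glb p q ]

    ≤-+∞ : ∀ {k} x y → [ 0ℤ ] ≤⁺ x → k ≤⁺ y → k ≤⁺ x +∞ y
    ≤-+∞ ⊤⁺    y     p     q     = _ ≤⊤⁺
    ≤-+∞ [ m ] ⊤⁺    p     q     = _ ≤⊤⁺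
    ≤-+∞ [ m ] [ n ] [ p ] [ q ] =
      [ ℤ.≤-trans (ℤ.≤-reflexive (≡.sym (ℤ.+-identityˡ _))) (ℤ.+-mono-≤ p q) ]

    ι-integral : ∀ a → [ 0ℤ ] ≤⁺ v (ι a)
    ι-integral a = Equivalence.from (integral (ι a)) (a , K.refl)

    resp : ∀ {k x y} → x O.≈ y → k ≤⁺ v (ι x) → k ≤⁺ v (ι y)
    resp {k} x≈y = ≡.subst (k ≤⁺_) (v-cong (F.⟦⟧-cong x≈y))

    cong-refl : ∀ n {x} → CongruentMod n x x
    cong-refl n {x} = ≡.subst ([ ℤ.+ n ] ≤⁺_) (≡.sym vx-x≡∞) (_ ≤⊤⁺)
      where
      vx-x≡∞ : v (ι (x O.- x)) ≡ ⊤⁺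
      vx-x≡∞ = Equivalence.from (v-∞ _)
        (K.trans (F.⟦⟧-cong (O.-‿inverseʳ x)) F.0#-homo)

    cong-sym : ∀ n {x y} → CongruentMod n x y → CongruentMod n y x
    cong-sym n {x} {y} p = resp lemma (≡.subst ([ ℤ.+ n ] ≤⁺_) (≡.sym (v-ι* _ _))
        (≤-+∞ _ _ (ι-integral (O.- O.1#)) p))
      where
      open RingProperties O.ring using (-1*x≈-x; ⁻¹-anti-homo‿-)
      v-ι* : ∀ a b → v (ι (a O.* b)) ≡ v (ι a) +∞ v (ι b)
      v-ι* a b = ≡.trans (v-cong (F.*-homo a b)) (v-* (ι a) (ι b))
      lemma : O.- O.1# O.* (x O.- y) O.≈ y O.- x
      lemma = O.trans (-1*x≈-x _) (⁻¹-anti-homo‿- x y)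

    cong-trans : ∀ n {x y z} →
      CongruentMod n x y → CongruentMod n y z → CongruentMod n x z
    cong-trans n {x} {y} {z} p q = resp lemma
        (≡.subst ([ ℤ.+ n ] ≤⁺_) (≡.sym (v-cong (F.+-homo _ _)))
          (≤⁺-trans ℤ.≤-trans (≤-⊓∞ _ _ p q) (v-+ _ _)))
      where
      open SetoidReasoning O.setoid
      lemma : (x O.- y) O.+ (y O.- z) O.≈ x O.- z
      lemma = begin
        (x O.- y) O.+ (y O.- z)         ≈⟨ O.+-assoc _ _ _ ⟩
        x O.+ (O.- y O.+ (y O.- z))     ≈⟨ O.+-congˡ (O.+-assoc _ _ _) ⟨
        x O.+ ((O.- y O.+ y) O.- z)     ≈⟨ O.+-congˡ (O.+-congʳ (O.-‿inverseˡ y)) ⟩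
        x O.+ (O.0# O.- z)              ≈⟨ O.+-congˡ (O.+-identityˡ _) ⟩
        x O.- z                         ∎

  -- The underlying set of O / 𝔪.
  residueField : Setoid c 0ℓ
  residueField = record
    { Carrier       = O.Carrier
    ; _≈_           = CongruentMod 1
    ; isEquivalence = record
      { refl = cong-refl 1 ; sym = cong-sym 1 ; trans = cong-trans 1 }
    }

  HasFiniteResidueField : Set c
  HasFiniteResidueField = ∃[ q ] Bijection (≡.setoid (Fin q)) residueField

------------------------------------------------------------------------
-- The game

data Player : Set where
  nora wanda : Player

opponent : Player → Player
opponent nora  = wanda
opponent wanda = nora

-- The player making move number n, counting from 0.
mover : (first : Player) → ℕ → Player
mover first zero    = first
mover first (suc n) = mover (opponent first) n

-- Degree d takes d + 1 moves, numbered 0, …, d.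
lastMover : (first : Player) (d : ℕ) → Player
lastMover first d = mover first d

module Game {c ℓ : Level} (K : Field c ℓ) (d : ℕ) where
  open Field K hiding (zero)
  open Exp semiring using (_^_)
  open Sum +-commutativeMonoid using (sum)

  -- Entry i is the coefficient of xⁱ.
  Polynomial : Set c
  Polynomial = Vec Carrier (suc d)

  eval : Polynomial → Carrier → Carrier
  eval f x = sum {suc d} λ i → lookup f i * x ^ toℕ i

  HasRoot : Polynomial → Set (c ⊔ ℓ)
  HasRoot f = ∃[ x ] eval f x ≈ 0#

  WonBy : Player → Polynomial → Set (c ⊔ ℓ)
  WonBy wanda f = HasRoot f
  WonBy nora  f = ¬ HasRoot f

  -- Unchosen coefficients are nothing.
  Position : Set c
  Position = Vec (Maybe Carrier) (suc d)

  start : Position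
  start = replicate (suc d) nothing

  Open : Position → Fin (suc d) → Set c
  Open p i = lookup p i ≡ nothing

  record Move (p : Position) : Set (c ⊔ ℓ) where
    field
      index : Fin (suc d)
      open′ : Open p index
      value : Carrier
      legal : index ≡ zero ⊎ index ≡ fromℕ d → ¬ value ≈ 0#

  play : (p : Position) → Move p → Position
  play p m = p [ index ]≔ just value
    where open Move m

  -- A strategy for P from position p with player t to move: a choice of move
  -- whenever it is P's turn, for every behaviour of the opponent.  The opponent
  -- may only be awaited while some coefficient is open, so every play
  -- continues until all of them have been chosen.
  data Strategy (P : Player) (t : Player) (p : Position) : Set (c ⊔ ℓ) where
    finished : (f : Polynomial) → p ≡ map just f → Strategy P t p
    choose   : t ≡ P → (m : Move p) →
               Strategy P (opponent t) (play p m) → Strategy P t p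
    await    : t ≢ P → ∃ (Open p) →
               (∀ m → Strategy P (opponent t) (play p m)) → Strategy P t p

  Winning : ∀ {P t p} → Strategy P t p → Set (c ⊔ ℓ)
  Winning {P} (finished f _) = WonBy P f
  Winning (choose _ _ s)     = Winning s
  Winning (await _ _ s)      = ∀ m → Winning (s m)

  HasWinningStrategy : (P first : Player) → Set (c ⊔ ℓ)
  HasWinningStrategy P first = Σ (Strategy P first start) Winning

{-# OPTIONS --safe #-}
module Submission where

-- Wanda, moving last at aⱼ, picks x ≠ 0 where the other terms do not cancel (one
-- end term dominates them when v(x) is extreme) and makes x a root.
--
-- Nora, moving last at aⱼ, wins outright if j is neither 1 nor d - 1, except that
-- for d = 4, j = 2 she needs a₁ = a₃ = 0: she makes v(aⱼ) very negative in residue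
-- classes for which the Newton polygon has no edge of integral slope.  So for d ≥ 5
-- she occupies 1 and d - 1 in time, and for d = 2, 4 similar care suffices.  Only
-- for d = 3 can she be left with a₀ + a₂ x² + a₃ x³; if its single slope is integral,
-- she rescales to e + t y² + y³ with e a unit and takes t outside the values of
-- - (e + y³) / y² modulo 𝔪, which y ≠ 0 cannot exhaust in a finite residue field.

open import Defs
open import Level using (Level; _⊔_)
open import Algebra.Bundles using (CommutativeRing)
open import Data.Empty using (⊥-elim)
open import Data.Fin.Base as Fin using (Fin; zero; suc; fromℕ; toℕ; inject₁; punchIn; punchOut)
open import Data.Fin.Patterns using (1F; 2F; 3F)
open import Data.Integer.Base as ℤ using (ℤ; +_; -[1+_]; 0ℤ; 1ℤ; ∣_∣; +≤+)
open import Data.Integer.Divisibility.Signed as ℤ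
  using (divides; ∣m∣n⇒∣m+n; ∣m∣n⇒∣m-n; ∣m⇒∣m*n; ∣⇒∣ᵤ)
open import Data.Integer.Tactic.RingSolver using (solve-∀)
open import Data.Maybe.Base using (Maybe; just; nothing)
open import Data.Maybe.Properties using (just-injective)
open import Data.Nat.Base as ℕ using (ℕ; zero; suc; z≤n; s≤s; _<_)
open import Data.Product.Base using (Σ; ∃; ∃-syntax; _×_; _,_; proj₁; proj₂)
open import Data.Sum.Base using (_⊎_; inj₁; inj₂; [_,_]′)
open import Data.Vec.Base using (Vec; []; _∷_; lookup; map; replicate; _[_]≔_)
open import Data.Vec.Properties
  using (lookup∘update; lookup∘update′; lookup-map; lookup-replicate; []≔-idempotent; map-[]≔)
open import Function.Base using (_∘_)
open import Function.Bundles using (Bijection; Equivalence)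
open import Relation.Binary.Construct.Add.Supremum.NonStrict ℤ._≤_
  using (_≤⁺_; [_]; _≤⊤⁺; ≤⁺-trans; [≤]-injective; ≤⁺-dec)
open import Relation.Binary.Definitions using (tri<; tri≈; tri>)
open import Relation.Binary.PropositionalEquality as ≡ using (_≡_; _≢_)
open import Relation.Nullary.Construct.Add.Supremum using (_⁺; [_]; ⊤⁺; ≡-dec)
open import Relation.Nullary.Decidable.Core using (Dec; yes; no; ¬?; _×-dec_; decidable-stable)
open import Relation.Nullary.Negation using (¬_; contradiction)

import Algebra.Properties.CommutativeMonoid.Sum as Sum
import Algebra.Properties.Ring as RingProperties
import Algebra.Properties.Semiring.Exp as Exp
import Algebra.Solver.Ring.NaturalCoefficients.Default as SemiringSolver
import Data.Fin.Properties as Fin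
import Data.Integer.Properties as ℤ
import Data.Nat.Divisibility as ℕ using (∣⇒≤)
import Data.Nat.Properties as ℕ
import Relation.Binary.Reasoning.Setoid as SetoidReasoning

-- Extended values and dominating terms.

[]-injective : ∀ {m n : ℤ} → _≡_ {A = ℤ ⁺} [ m ] [ n ] → m ≡ n
[]-injective ≡.refl = ≡.refl

+∞-mono-≤⁺ : ∀ {m n x y} → [ m ] ≤⁺ x → [ n ] ≤⁺ y → [ m ℤ.+ n ] ≤⁺ x +∞ y
+∞-mono-≤⁺ [ p ]     [ q ]     = [ ℤ.+-mono-≤ p q ]
+∞-mono-≤⁺ [ p ]     (_ ≤⊤⁺)   = _ ≤⊤⁺
+∞-mono-≤⁺ (_ ≤⊤⁺)   q         = _ ≤⊤⁺

⊓∞-glb : ∀ {k x y} → k ≤⁺ x → k ≤⁺ y → k ≤⁺ x ⊓∞ y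
⊓∞-glb {y = y} (_ ≤⊤⁺) q       = q
⊓∞-glb         [ p ]   [ q ]   = [ ℤ.⊓-glb p q ]
⊓∞-glb         [ p ]   (_ ≤⊤⁺) = [ p ]

IsEnd : ∀ {d} → Fin (suc d) → Set
IsEnd {d} k = k ≡ zero ⊎ k ≡ fromℕ d

-- The strict minimum that rules out cancellation. Strictly above `m` is written as at least
-- `ℤ.suc m`, so that only the order `_≤⁺_` occurs.
Dominates : ∀ {n} → (Fin n → ℤ ⁺) → Fin n → Set
Dominates V i = ∃[ m ] V i ≡ [ m ] × (∀ k → k ≢ i → [ ℤ.suc m ] ≤⁺ V k)

-- A common factor of value `s` does not change which term dominates. This lets weights be counted
-- from the top coefficient as well as from the bottom one.
dominates-shift : ∀ {n} {V W : Fin n → ℤ ⁺} {i} s →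
                  (∀ k → W k ≡ V k +∞ [ s ]) → Dominates V i → Dominates W i
dominates-shift {i = i} s eq (m , Vi≡m , rest) =
  m ℤ.+ s , ≡.trans (eq i) (≡.cong (_+∞ [ s ]) Vi≡m) , λ k k≢i →
  ≡.subst₂ (λ a b → [ a ] ≤⁺ b) (ℤ.+-assoc 1ℤ m s) (≡.sym (eq k))
    (+∞-mono-≤⁺ (rest k k≢i) [ ℤ.≤-refl ])

-- A weight of at least 1 raises `x` by more than `2B`, and the gap between the lower bound `- B`
-- and `α` is at most `2B`.
far : ∀ {x w B α n} → [ ℤ.- + B ] ≤⁺ x → α ℤ.≤ + B → 1 ℕ.≤ w → B ℕ.+ B ℕ.< n →
      [ ℤ.suc α ] ≤⁺ x +∞ [ + (w ℕ.* n) ]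
far {x} {w} {B} {α} {n} B≤x α≤B 1≤w 2B<n =
  ≤⁺-trans ℤ.≤-trans [ bound ] (+∞-mono-≤⁺ B≤x [ ℤ.≤-refl ])
  where
  open ℤ.≤-Reasoning
  n≤wn : n ℕ.≤ w ℕ.* n
  n≤wn = ≡.subst (ℕ._≤ w ℕ.* n) (ℕ.*-identityˡ n) (ℕ.*-monoˡ-≤ n 1≤w)
  cancel : ∀ b → 1ℤ ℤ.+ b ≡ ℤ.- b ℤ.+ (1ℤ ℤ.+ (b ℤ.+ b))
  cancel = solve-∀
  bound : ℤ.suc α ℤ.≤ ℤ.- + B ℤ.+ + (w ℕ.* n)
  bound = begin
    ℤ.suc α                           ≤⟨ ℤ.suc-mono α≤B ⟩
    ℤ.suc (+ B)                       ≡⟨ cancel (+ B) ⟩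
    ℤ.- + B ℤ.+ + suc (B ℕ.+ B)      ≤⟨ ℤ.+-monoʳ-≤ (ℤ.- + B) (+≤+ (ℕ.≤-trans 2B<n n≤wn)) ⟩
    ℤ.- + B ℤ.+ + (w ℕ.* n)          ∎

near : ∀ {x B t u} → t ℤ.< ℤ.- + B → [ ℤ.- + B ] ≤⁺ x → [ ℤ.suc t ] ≤⁺ x +∞ [ + u ]
near {t = t} {u} t<B B≤x =
  ≡.subst (λ s → [ s ] ≤⁺ _) (ℤ.+-identityʳ (ℤ.suc t))
    (+∞-mono-≤⁺ (≤⁺-trans ℤ.≤-trans [ ℤ.i<j⇒suc[i]≤j t<B ] B≤x) [ +≤+ {n = u} z≤n ])

-- The Newton polygon argument: for small n the very negative T at j wins, and
-- for large n only j and the end e compete, and their values are never equal.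
one-dominates : ∀ {N} (V : Fin N → ℤ ⁺) (w : Fin N → ℕ) e j {d B T} →
  V j ≡ [ T ] → (∀ k → k ≢ j → [ ℤ.- + B ] ≤⁺ V k) →
  (∀ k → w k ℕ.≤ d) → w e ≡ 0 → (∀ k → k ≢ e → 1 ℕ.≤ w k) →
  T ℤ.+ + (d ℕ.* (B ℕ.+ B)) ℤ.< ℤ.- + B →
  (e ≢ j → ∃[ α ] V e ≡ [ α ] × α ℤ.≤ + B × (∀ n → T ℤ.+ + (w j ℕ.* n) ≢ α)) →
  ∀ n → ∃ (Dominates (λ k → V k +∞ [ + (w k ℕ.* n) ]))
one-dominates V w e j {d} {B} {T} Vj≡T B≤V w≤d we≡0 1≤w T-small end n
  with T ℤ.+ + (w j ℕ.* n) ℤ.<? ℤ.- + B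
... | yes small = j , _ , ≡.cong (_+∞ _) Vj≡T , λ k k≢j → near small (B≤V k k≢j)
... | no ¬small = compare (ℤ.<-cmp (T ℤ.+ + (w j ℕ.* n)) α)
  where
  T+-mono : ∀ {a b} → a ℕ.≤ b → T ℤ.+ + a ℤ.≤ T ℤ.+ + b
  T+-mono = ℤ.+-monoʳ-≤ T ∘ +≤+
  -- With weight 0 the value at `j` would stay at `T`, which `T-small` puts below `- B`.
  e≢j : e ≢ j
  e≢j ≡.refl = ¬small (ℤ.≤-<-trans
    (T+-mono {b = d ℕ.* (B ℕ.+ B)} (≡.subst (λ u → u ℕ.* n ℕ.≤ d ℕ.* (B ℕ.+ B)) (≡.sym we≡0) z≤n)) T-small)
  -- For `n ≤ 2B` the value at `j` has risen by at most `2dB`, and `T-small` keeps it below `- B`.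
  2B<n : B ℕ.+ B ℕ.< n
  2B<n with n ℕ.≤? B ℕ.+ B
  ... | yes n≤2B = contradiction
    (ℤ.≤-<-trans (T+-mono (ℕ.*-mono-≤ (w≤d j) n≤2B)) T-small) ¬small
  ... | no  n≰2B = ℕ.≰⇒> n≰2B
  α    = proj₁ (end e≢j)
  Ve≡α = proj₁ (proj₂ (end e≢j))
  α≤B  = proj₁ (proj₂ (proj₂ (end e≢j)))
  V′ : Fin _ → ℤ ⁺
  V′ k = V k +∞ [ + (w k ℕ.* n) ]
  V′e≡α : V′ e ≡ [ α ]
  V′e≡α = ≡.trans (≡.cong₂ (λ x u → x +∞ [ + (u ℕ.* n) ]) Ve≡α we≡0)
                  (≡.cong [_] (ℤ.+-identityʳ α))
  V′j≡ : V′ j ≡ [ T ℤ.+ + (w j ℕ.* n) ]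
  V′j≡ = ≡.cong (_+∞ _) Vj≡T
  others : ∀ k → k ≢ j → k ≢ e → [ ℤ.suc α ] ≤⁺ V′ k
  others k k≢j k≢e = far (B≤V k k≢j) α≤B (1≤w k k≢e) 2B<n
  compare : _ → ∃ (Dominates V′)
  compare (tri≈ _ eq _) = contradiction eq (proj₂ (proj₂ (proj₂ (end e≢j))) n)
  compare (tri< lt _ _) = j , _ , V′j≡ , above
    where
    above : ∀ k → k ≢ j → [ ℤ.suc (T ℤ.+ + (w j ℕ.* n)) ] ≤⁺ V′ k
    above k k≢j with k Fin.≟ e
    ... | yes ≡.refl = ≡.subst (_ ≤⁺_) (≡.sym V′e≡α) [ ℤ.i<j⇒suc[i]≤j lt ]
    ... | no k≢e = ≤⁺-trans ℤ.≤-trans [ ℤ.suc-mono (ℤ.<⇒≤ lt) ] (others k k≢j k≢e)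
  compare (tri> _ _ gt) = e , _ , V′e≡α , above
    where
    above : ∀ k → k ≢ e → [ ℤ.suc α ] ≤⁺ V′ k
    above k k≢e with k Fin.≟ j
    ... | yes ≡.refl = ≡.subst ([ ℤ.suc α ] ≤⁺_) (≡.sym V′j≡) [ ℤ.i<j⇒suc[i]≤j gt ]
    ... | no k≢j = others k k≢j k≢e

-- Bounds on values, and low integers outside given residue classes.

uniform-bound : ∀ {n} (g : Fin n → ℕ) → ∃[ B ] ∀ k → g k ℕ.≤ B
uniform-bound {zero}  g = 0 , λ ()
uniform-bound {suc n} g = let B , g≤B = uniform-bound (g ∘ suc) in
  g zero ℕ.⊔ B , λ where
    zero    → ℕ.m≤m⊔n (g zero) B
    (suc k) → ℕ.≤-trans (g≤B k) (ℕ.m≤n⊔m (g zero) B)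

i≤∣i∣ : ∀ i → i ℤ.≤ + ∣ i ∣
i≤∣i∣ (+ n)    = ℤ.≤-refl
i≤∣i∣ -[1+ n ] = ℤ.-≤+

-- The value `0ℤ` at `⊤⁺` is a dummy: it is harmless in bounds, and elsewhere the element in
-- question is known to be nonzero.
finite : ℤ ⁺ → ℤ
finite [ n ] = n
finite ⊤⁺    = 0ℤ

valuation-bound : ∀ {n} (V : Fin n → ℤ ⁺) →
  ∃[ B ] ∀ k → [ ℤ.- + B ] ≤⁺ V k × finite (V k) ℤ.≤ + B
valuation-bound V with uniform-bound (∣_∣ ∘ finite ∘ V)
... | B , ∣V∣≤B = B , λ k → lower (V k) (∣V∣≤B k)
                          , ℤ.≤-trans (i≤∣i∣ (finite (V k))) (+≤+ (∣V∣≤B k))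
  where
  lower : ∀ x → ∣ finite x ∣ ℕ.≤ B → [ ℤ.- + B ] ≤⁺ x
  lower ⊤⁺    _ = _ ≤⊤⁺
  lower [ n ] p = [ ≡.subst (ℤ.- + B ℤ.≤_) (ℤ.neg-involutive n) (ℤ.neg-mono-≤
    (ℤ.≤-trans (i≤∣i∣ (ℤ.- n)) (+≤+ (≡.subst (ℕ._≤ B) (≡.sym (ℤ.∣-i∣≡∣i∣ n)) p)))) ]

below : ∀ p .{{_ : ℕ.NonZero p}} α M → ∃[ L ] α ℤ.- + p ℤ.* L ℤ.≤ M
below p α M = + L , (begin
  α ℤ.- + p ℤ.* + L         ≤⟨ ℤ.+-monoʳ-≤ α (ℤ.neg-mono-≤ L≤pL) ⟩
  α ℤ.- + L                 ≤⟨ ℤ.+-monoʳ-≤ α (ℤ.neg-mono-≤ (i≤∣i∣ (α ℤ.- M))) ⟩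
  α ℤ.- (α ℤ.- M)           ≡⟨ cancel α M ⟩
  M                         ∎)
  where
  open ℤ.≤-Reasoning
  L = ∣ α ℤ.- M ∣
  L≤pL : + L ℤ.≤ + p ℤ.* + L
  L≤pL = ≡.subst (+ L ℤ.≤_) (ℤ.pos-* p L) (+≤+ (ℕ.m≤n*m L p))
  cancel : ∀ a m → a ℤ.- (a ℤ.- m) ≡ m
  cancel = solve-∀

∤-small : ∀ {p} r .{{_ : ℕ.NonZero r}} → r ℕ.< p → ¬ + p ℤ.∣ + r
∤-small r r<p p∣r = ℕ.<⇒≱ r<p (ℕ.∣⇒≤ (∣⇒∣ᵤ p∣r))

-- `T` is a low member of the class of `1 + α`, and `p ≥ 2` does not divide 1.
avoid-one : ∀ p → 2 ℕ.≤ p → ∀ α M → ∃[ T ] T ℤ.≤ M × ¬ + p ℤ.∣ T ℤ.- α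
avoid-one p@(suc _) 2≤p α M with below p (1ℤ ℤ.+ α) M
... | L , T≤M = 1ℤ ℤ.+ α ℤ.- + p ℤ.* L , T≤M , λ div →
  ∤-small 1 2≤p (≡.subst (+ p ℤ.∣_) (cancel α (+ p ℤ.* L))
    (∣m∣n⇒∣m+n div (∣m⇒∣m*n L (ℤ.∣-refl {+ p}))))
  where
  cancel : ∀ a l → (1ℤ ℤ.+ a ℤ.- l) ℤ.- a ℤ.+ l ≡ 1ℤ
  cancel = solve-∀

-- The consecutive candidates `T 1` and `T 2` are 1 and 2 above `α` modulo `p`, so `p ≥ 3` excludes
-- neither. Since they differ by 1 and `q ≥ 2`, at most one of them lies in the class of `δ`.
avoid-two : ∀ p q → 3 ℕ.≤ p → 2 ℕ.≤ q → ∀ α δ M →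
  ∃[ T ] T ℤ.≤ M × ¬ + p ℤ.∣ T ℤ.- α × ¬ + q ℤ.∣ T ℤ.- δ
avoid-two p@(suc _) q@(suc _) 3≤p 2≤q α δ M = choose (+ q ℤ.∣? T 1 ℤ.- δ)
  where
  L = proj₁ (below (p ℕ.* q) (+ 2 ℤ.+ α) M)
  l = + (p ℕ.* q) ℤ.* L
  T : ℕ → ℤ
  T r = + r ℤ.+ α ℤ.- l
  T₂≤M : T 2 ℤ.≤ M
  T₂≤M = proj₂ (below (p ℕ.* q) (+ 2 ℤ.+ α) M)
  T₁≤T₂ : T 1 ℤ.≤ T 2
  T₁≤T₂ = ℤ.+-monoˡ-≤ (ℤ.- l) (ℤ.+-monoˡ-≤ α (+≤+ (s≤s z≤n)))
  cancel : ∀ r a l → (r ℤ.+ a ℤ.- l) ℤ.- a ℤ.+ l ≡ r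
  cancel = solve-∀
  step : ∀ a l d → (+ 2 ℤ.+ a ℤ.- l ℤ.- d) ℤ.- (1ℤ ℤ.+ a ℤ.- l ℤ.- d) ≡ 1ℤ
  step = solve-∀
  p∣l : + p ℤ.∣ l
  p∣l = ∣m⇒∣m*n L (≡.subst (+ p ℤ.∣_) (≡.sym (ℤ.pos-* p q))
    (∣m⇒∣m*n (+ q) (ℤ.∣-refl {+ p})))
  p∤ : ∀ r .{{_ : ℕ.NonZero r}} → r ℕ.< p → ¬ + p ℤ.∣ T r ℤ.- α
  p∤ r r<p div = ∤-small r r<p
    (≡.subst (+ p ℤ.∣_) (cancel (+ r) α l) (∣m∣n⇒∣m+n div p∣l))
  choose : Dec (+ q ℤ.∣ T 1 ℤ.- δ) →
           ∃[ T ] T ℤ.≤ M × ¬ + p ℤ.∣ T ℤ.- α × ¬ + q ℤ.∣ T ℤ.- δ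
  choose (no ∤δ)  = T 1 , ℤ.≤-trans T₁≤T₂ T₂≤M , p∤ 1 (ℕ.≤-trans (s≤s (s≤s z≤n)) 3≤p) , ∤δ
  choose (yes ∣δ) = T 2 , T₂≤M , p∤ 2 3≤p , λ div → ∤-small 1 2≤q
    (≡.subst (+ q ℤ.∣_) (step α l δ) (∣m∣n⇒∣m-n div ∣δ))

-- Equality would give the Newton polygon an edge of integral slope, that is, `T - α` would be a
-- multiple of `p`.
∤⇒≢ : ∀ {p T α} → ¬ + p ℤ.∣ T ℤ.- α → ∀ n → T ℤ.+ + (p ℕ.* n) ≢ α
∤⇒≢ {p} {T} ∤ n ≡.refl = ∤ (divides (ℤ.- + n)
  (≡.trans (≡.cong (λ u → T ℤ.- (T ℤ.+ u)) (ℤ.pos-* p n)) (cancel T (+ p) (+ n))))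
  where
  cancel : ∀ t p n → t ℤ.- (t ℤ.+ p ℤ.* n) ≡ ℤ.- n ℤ.* p
  cancel = solve-∀

-- Fields with a discrete valuation.

module Valued {c ℓ : Level} (K : Field c ℓ) (𝓥 : DiscreteValuation K) where
  open Field K hiding (zero)
  open DiscreteValuation 𝓥
  open RingProperties ring using (-1*x≈-x; -‿involutive; +-cancelʳ; -0#≈0#)
  open Exp semiring using (_^_)
  open Sum +-commutativeMonoid using (sum; sum-remove; sum-cong-≋)

  finite⇒≉0 : ∀ {x n} → v x ≡ [ n ] → ¬ x ≈ 0#
  finite⇒≉0 vx≡n x≈0 with () ← ≡.trans (≡.sym vx≡n) (Equivalence.from (v-∞ _) x≈0)

  ≉0⇒finite : ∀ {x} → ¬ x ≈ 0# → v x ≡ [ finite (v x) ]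
  ≉0⇒finite {x} x≉0 with v x in eq
  ... | ⊤⁺    = contradiction (Equivalence.to (v-∞ x) eq) x≉0
  ... | [ n ] = ≡.refl

  v-0 : ∀ {x} → x ≈ 0# → v x ≡ ⊤⁺
  v-0 = Equivalence.from (v-∞ _)

  v-1 : v 1# ≡ [ 0ℤ ]
  v-1 = ≡.trans v1≡n (≡.cong [_] (idem ([]-injective
    (≡.trans (≡.sym (≡.trans (v-* 1# 1#) (≡.cong₂ _+∞_ v1≡n v1≡n)))
             (≡.trans (v-cong (*-identityˡ 1#)) v1≡n)))))
    where
    n = finite (v 1#)
    v1≡n : v 1# ≡ [ n ]
    v1≡n = ≉0⇒finite 1≉0
    cancel : ∀ k → k ≡ (k ℤ.+ k) ℤ.- k
    cancel = solve-∀
    idem : ∀ {k} → k ℤ.+ k ≡ k → k ≡ 0ℤ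
    idem {k} eq = ≡.trans (cancel k) (≡.trans (≡.cong (ℤ._- k) eq) (ℤ.+-inverseʳ k))

  -- The square of `- 1#` is `1#`, and twice an integer vanishes only if the integer does.
  v-neg1 : v (- 1#) ≡ [ 0ℤ ]
  v-neg1 = ≡.trans vx≡n (≡.cong [_] (twice ([]-injective
    (≡.trans (≡.sym (≡.trans (v-* (- 1#) (- 1#)) (≡.cong₂ _+∞_ vx≡n vx≡n)))
             (≡.trans (v-cong (trans (-1*x≈-x (- 1#)) (-‿involutive 1#))) v-1)))))
    where
    -1≉0 : ¬ - 1# ≈ 0#
    -1≉0 eq = 1≉0 (trans (sym (-‿involutive 1#)) (trans (-‿cong eq) -0#≈0#))
    n = finite (v (- 1#))
    vx≡n : v (- 1#) ≡ [ n ]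
    vx≡n = ≉0⇒finite -1≉0
    twice : ∀ {k} → k ℤ.+ k ≡ 0ℤ → k ≡ 0ℤ
    twice {+ zero} _ = ≡.refl

  v-neg : ∀ x → v (- x) ≡ v x
  v-neg x = ≡.trans (v-cong (sym (-1*x≈-x x))) (≡.trans (v-* (- 1#) x)
    (≡.trans (≡.cong (_+∞ v x) v-neg1) (0+ (v x))))
    where
    0+ : ∀ y → [ 0ℤ ] +∞ y ≡ y
    0+ ⊤⁺    = ≡.refl
    0+ [ n ] = ≡.cong [_] (ℤ.+-identityˡ n)

  v≥-0 : ∀ {k} → k ≤⁺ v 0#
  v≥-0 {k} = ≡.subst (k ≤⁺_) (≡.sym (v-0 refl)) (_ ≤⊤⁺)

  v≥-+ : ∀ {k x y} → k ≤⁺ v x → k ≤⁺ v y → k ≤⁺ v (x + y)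
  v≥-+ p q = ≤⁺-trans ℤ.≤-trans (⊓∞-glb p q) (v-+ _ _)

  v≥-neg : ∀ {k x} → k ≤⁺ v x → k ≤⁺ v (- x)
  v≥-neg {k} {x} = ≡.subst (k ≤⁺_) (≡.sym (v-neg x))

  v≥-* : ∀ {m n x y} → [ m ] ≤⁺ v x → [ n ] ≤⁺ v y → [ m ℤ.+ n ] ≤⁺ v (x * y)
  v≥-* p q = ≡.subst (_ ≤⁺_) (≡.sym (v-* _ _)) (+∞-mono-≤⁺ p q)

  v≥-resp : ∀ {k x y} → x ≈ y → k ≤⁺ v x → k ≤⁺ v y
  v≥-resp {k} x≈y = ≡.subst (k ≤⁺_) (v-cong x≈y)

  v≥-sum : ∀ {k n} (g : Fin n → Carrier) → (∀ i → k ≤⁺ v (g i)) → k ≤⁺ v (sum g)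
  v≥-sum {n = zero}  g p = v≥-0
  v≥-sum {n = suc n} g p = v≥-+ (p zero) (v≥-sum (g ∘ suc) (p ∘ suc))

  ≈-neg : ∀ {x y} → x + y ≈ 0# → x ≈ - y
  ≈-neg {x} {y} eq = +-cancelʳ y x (- y) (trans eq (sym (-‿inverseˡ y)))

  -- If the sum vanished, the dominating term would be minus the sum of the others, whose value is
  -- at least `ℤ.suc m`.
  dominates⇒≉0 : ∀ {n} (g : Fin (suc n) → Carrier) {i} →
                 Dominates (v ∘ g) i → ¬ sum g ≈ 0#
  dominates⇒≉0 g {i} (m , vgi≡m , rest) sum≈0 =
    ℤ.<-irrefl ≡.refl (ℤ.suc[i]≤j⇒i<j ([≤]-injective
      (≡.subst ([ ℤ.suc m ] ≤⁺_) vgi≡m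
        (v≥-resp (sym (≈-neg (trans (sym (sum-remove {i = i} g)) sum≈0)))
          (v≥-neg (v≥-sum _ (λ k → rest (punchIn i k) (Fin.punchInᵢ≢i i k))))))))

  v-^ : ∀ {x n} → v x ≡ [ n ] → ∀ k → v (x ^ k) ≡ [ + k ℤ.* n ]
  v-^ {n = n} vx≡n zero    = ≡.trans v-1 (≡.cong [_] (≡.sym (ℤ.*-zeroˡ n)))
  v-^ {n = n} vx≡n (suc k) = ≡.trans (v-* _ _)
    (≡.trans (≡.cong₂ _+∞_ vx≡n (v-^ vx≡n k)) (≡.cong [_] (step n (+ k))))
    where
    step : ∀ n k → n ℤ.+ k ℤ.* n ≡ (1ℤ ℤ.+ k) ℤ.* n
    step = solve-∀

  -- Newton polygons and winning last moves.

  module Polynomials (d : ℕ) where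
    open Game K d using (Polynomial; eval; HasRoot)

    V : Polynomial → Fin (suc d) → ℤ ⁺
    V f k = v (lookup f k)

    v-term : ∀ f {x n} → v x ≡ [ n ] → ∀ k →
             v (lookup f k * x ^ toℕ k) ≡ V f k +∞ [ + toℕ k ℤ.* n ]
    v-term f vx≡n k = ≡.trans (v-* _ _) (≡.cong (V f k +∞_) (v-^ vx≡n (toℕ k)))

    eval≉0 : ∀ f {x n} → v x ≡ [ n ] →
             ∃ (Dominates (λ k → V f k +∞ [ + toℕ k ℤ.* n ])) → ¬ eval f x ≈ 0#
    eval≉0 f {x} vx≡n (i , m , Vi≡m , rest) = dominates⇒≉0 _ {i}
      ( m , ≡.trans (v-term f vx≡n i) Vi≡m
      , λ k k≢i → ≡.subst ([ ℤ.suc m ] ≤⁺_) (≡.sym (v-term f vx≡n k)) (rest k k≢i))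

    no-root : ∀ f → ¬ lookup f zero ≈ 0# →
              (∀ n → ∃ (Dominates (λ k → V f k +∞ [ + toℕ k ℤ.* n ]))) → ¬ HasRoot f
    no-root f f₀≉0 dom (x , root) with v x in vx≡
    ... | [ n ] = eval≉0 f vx≡ (dom n) root
    -- At `x = 0` every term but the constant one has value `⊤⁺`, so the constant term dominates.
    ... | ⊤⁺    = dominates⇒≉0 _ {zero} (finite (V f zero) , v₀ , rest) root
      where
      v₀ : v (lookup f zero * 1#) ≡ [ finite (V f zero) ]
      v₀ = ≡.trans (v-cong (*-identityʳ _)) (≉0⇒finite f₀≉0)
      +⊤ : ∀ y → y +∞ ⊤⁺ ≡ ⊤⁺
      +⊤ ⊤⁺    = ≡.refl
      +⊤ [ _ ] = ≡.refl
      rest : ∀ k → k ≢ zero → _ ≤⁺ v (lookup f k * x ^ toℕ k)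
      rest zero    k≢0 = contradiction ≡.refl k≢0
      rest (suc k) _   = ≡.subst ([ ℤ.suc (finite (V f zero)) ] ≤⁺_) (≡.sym (≡.trans (v-* _ _) (≡.trans
        (≡.cong (V f (suc k) +∞_) (≡.trans (v-* _ _) (≡.cong (_+∞ v (x ^ toℕ k)) vx≡)))
        (+⊤ (V f (suc k)))))) (_ ≤⊤⁺)

    from-start : ∀ (U : Fin (suc d) → ℤ ⁺) {i} n →
      Dominates (λ k → U k +∞ [ + (toℕ k ℕ.* n) ]) i →
      Dominates (λ k → U k +∞ [ + toℕ k ℤ.* + n ]) i
    from-start U n = dominates-shift 0ℤ λ k → ≡.sym (≡.trans (+0 (U k +∞ _))
      (≡.cong (λ u → U k +∞ [ u ]) (ℤ.pos-* (toℕ k) n)))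
      where
      +0 : ∀ y → y +∞ [ 0ℤ ] ≡ y
      +0 ⊤⁺    = ≡.refl
      +0 [ n ] = ≡.cong [_] (ℤ.+-identityʳ n)

    -- For `v x = - n`, the terms have values shifted by `- k n`, which is `(d - k) n` less the
    -- constant `d n`. Natural weights counted from the leading coefficient therefore cover the
    -- negative values of `x`.
    from-end : ∀ (U : Fin (suc d) → ℤ ⁺) {i} n →
      Dominates (λ k → U k +∞ [ + ((d ℕ.∸ toℕ k) ℕ.* n) ]) i →
      Dominates (λ k → U k +∞ [ + toℕ k ℤ.* ℤ.- + n ]) i
    from-end U n = dominates-shift (ℤ.- (+ d ℤ.* + n)) λ k → ≡.sym
      (≡.trans (assoc (U k) _ _) (≡.cong (λ u → U k +∞ [ u ]) (shift k)))
      where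
      assoc : ∀ y a b → (y +∞ [ a ]) +∞ [ b ] ≡ y +∞ [ a ℤ.+ b ]
      assoc ⊤⁺    a b = ≡.refl
      assoc [ m ] a b = ≡.cong [_] (ℤ.+-assoc m a b)
      ring-eq : ∀ e k n → e ℤ.* n ℤ.+ ℤ.- ((e ℤ.+ k) ℤ.* n) ≡ k ℤ.* ℤ.- n
      ring-eq = solve-∀
      shift : ∀ k → + ((d ℕ.∸ toℕ k) ℕ.* n) ℤ.+ ℤ.- (+ d ℤ.* + n)
                    ≡ + toℕ k ℤ.* ℤ.- + n
      shift k = ≡.trans
        (≡.cong₂ (λ a b → a ℤ.+ ℤ.- (b ℤ.* + n)) (ℤ.pos-* (d ℕ.∸ toℕ k) n)
          (≡.cong +_ (≡.sym (ℕ.m∸n+n≡m (Fin.toℕ≤pred[n] k)))))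
        (ring-eq (+ (d ℕ.∸ toℕ k)) (+ toℕ k) (+ n))

    from-both-ends : ∀ (U : Fin (suc d) → ℤ ⁺) →
      (∀ n → ∃ (Dominates (λ k → U k +∞ [ + (toℕ k ℕ.* n) ]))) →
      (∀ n → ∃ (Dominates (λ k → U k +∞ [ + ((d ℕ.∸ toℕ k) ℕ.* n) ]))) →
      ∀ n → ∃ (Dominates (λ k → U k +∞ [ + toℕ k ℤ.* n ]))
    from-both-ends U pos neg (+ n)    = _ , from-start U n (proj₂ (pos n))
    from-both-ends U pos neg -[1+ n ] = _ , from-end U (suc n) (proj₂ (neg (suc n)))

    0<toℕ : ∀ (k : Fin (suc d)) → k ≢ zero → 1 ℕ.≤ toℕ k
    0<toℕ zero    k≢0 = contradiction ≡.refl k≢0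
    0<toℕ (suc k) _   = s≤s z≤n

    d∸d≡0 : d ℕ.∸ toℕ (fromℕ d) ≡ 0
    d∸d≡0 = ≡.trans (≡.cong (d ℕ.∸_) (Fin.toℕ-fromℕ d)) (ℕ.n∸n≡0 d)

    0<d∸toℕ : ∀ (k : Fin (suc d)) → k ≢ fromℕ d → 1 ℕ.≤ d ℕ.∸ toℕ k
    0<d∸toℕ k k≢d = ℕ.m<n⇒0<n∸m (ℕ.≤∧≢⇒< (Fin.toℕ≤pred[n] k)
      λ eq → k≢d (Fin.toℕ-injective (≡.trans eq (≡.sym (Fin.toℕ-fromℕ d)))))

    -- A very negative last coefficient in suitable residue classes leaves no
    -- integral slope on the Newton polygon.
    nora-finishes : ∀ f j →
      (∀ k → IsEnd k → k ≢ j → ¬ lookup f k ≈ 0#) →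
      (∀ M → ∃[ T ] T ℤ.≤ M ×
        (zero ≢ j → ¬ + toℕ j ℤ.∣ T ℤ.- finite (V f zero)) ×
        (fromℕ d ≢ j → ¬ + (d ℕ.∸ toℕ j) ℤ.∣ T ℤ.- finite (V f (fromℕ d)))) →
      ∃[ a ] (¬ a ≈ 0#) × ¬ HasRoot (f [ j ]≔ a)
    nora-finishes f j ends choice with valuation-bound (V f)
    -- This threshold gives `T + 2dB < - B`: as long as the shift is at most `2B` per degree, the
    -- new coefficient stays below all others.
    ... | B , bound with choice (ℤ.- + B ℤ.- (1ℤ ℤ.+ + (d ℕ.* (B ℕ.+ B))))
    ... | T , T≤M , T₀ , T₁ with v-surjective T
    ... | a , va≡T = a , a≉0 , no-root f′ f′₀≉0 (from-both-ends (V f′)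
      (one-dominates (V f′) toℕ zero j Vj≡T V≥B Fin.toℕ≤pred[n] ≡.refl 0<toℕ T-small
        (end zero (inj₁ ≡.refl) T₀))
      (one-dominates (V f′) (λ k → d ℕ.∸ toℕ k) (fromℕ d) j Vj≡T V≥B
        (λ k → ℕ.m∸n≤m d (toℕ k)) d∸d≡0 0<d∸toℕ T-small
        (end (fromℕ d) (inj₂ ≡.refl) T₁)))
      where
      D = + (d ℕ.* (B ℕ.+ B))
      f′ = f [ j ]≔ a
      a≉0 : ¬ a ≈ 0#
      a≉0 = finite⇒≉0 va≡T
      Vj≡T : V f′ j ≡ [ T ]
      Vj≡T = ≡.trans (≡.cong v (lookup∘update j f a)) va≡T
      V≢j : ∀ {k} → k ≢ j → V f′ k ≡ V f k
      V≢j k≢j = ≡.cong v (lookup∘update′ k≢j f a)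
      V≥B : ∀ k → k ≢ j → [ ℤ.- + B ] ≤⁺ V f′ k
      V≥B k k≢j = ≡.subst (_ ≤⁺_) (≡.sym (V≢j k≢j)) (proj₁ (bound k))
      T-small : T ℤ.+ D ℤ.< ℤ.- + B
      T-small = ℤ.suc[i]≤j⇒i<j (begin
        1ℤ ℤ.+ (T ℤ.+ D)           ≡⟨ reorder T D ⟩
        T ℤ.+ (1ℤ ℤ.+ D)           ≤⟨ ℤ.+-monoˡ-≤ (1ℤ ℤ.+ D) T≤M ⟩
        ℤ.- + B ℤ.- (1ℤ ℤ.+ D) ℤ.+ (1ℤ ℤ.+ D)  ≡⟨ cancel (ℤ.- + B) (1ℤ ℤ.+ D) ⟩
        ℤ.- + B                    ∎)
        where
        open ℤ.≤-Reasoning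
        reorder : ∀ t d → 1ℤ ℤ.+ (t ℤ.+ d) ≡ t ℤ.+ (1ℤ ℤ.+ d)
        reorder = solve-∀
        cancel : ∀ b d → b ℤ.- d ℤ.+ d ≡ b
        cancel = solve-∀
      end : ∀ e {p} → IsEnd e → (e ≢ j → ¬ + p ℤ.∣ T ℤ.- finite (V f e)) → e ≢ j →
            ∃[ α ] V f′ e ≡ [ α ] × α ℤ.≤ + B × (∀ n → T ℤ.+ + (p ℕ.* n) ≢ α)
      end e isEnd ∤ e≢j = finite (V f e)
        , ≡.trans (V≢j e≢j) (≉0⇒finite (ends e isEnd e≢j))
        , proj₂ (bound e) , ∤⇒≢ {T = T} (∤ e≢j)
      f′₀≉0 : ¬ lookup f′ zero ≈ 0#
      f′₀≉0 with zero Fin.≟ j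
      ... | yes ≡.refl = a≉0 ∘ trans (reflexive (≡.sym (lookup∘update zero f a)))
      ... | no 0≢j = ends zero (inj₁ ≡.refl) 0≢j ∘ trans (reflexive (≡.sym (lookup∘update′ 0≢j f a)))

    remainder : Polynomial → Fin (suc d) → Carrier → Carrier
    remainder f j x = sum λ k → lookup f (punchIn j k) * x ^ toℕ (punchIn j k)

    eval-update : ∀ f j a x → eval (f [ j ]≔ a) x ≈ a * x ^ toℕ j + remainder f j x
    eval-update f j a x = trans (sum-remove {i = j} λ k → lookup (f [ j ]≔ a) k * x ^ toℕ k) (+-cong
      (*-congʳ (reflexive (lookup∘update j f a)))
      (sum-cong-≋ λ k → *-congʳ (reflexive (lookup∘update′ (Fin.punchInᵢ≢i j k) f a))))

    -- `N = 2B + 1` is just past the threshold of `far`, and the end `e`, of weight 0, is the only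
    -- term that is not raised.
    far-from : ∀ f (w : Fin (suc d) → ℕ) e → ¬ lookup f e ≈ 0# → w e ≡ 0 →
      (∀ k → k ≢ e → 1 ℕ.≤ w k) →
      ∃[ N ] Dominates (λ k → V f k +∞ [ + (w k ℕ.* N) ]) e
    far-from f w e fe≉0 we≡0 1≤w with valuation-bound (V f)
    ... | B , bound = suc (B ℕ.+ B) , finite (V f e)
      , ≡.trans (≡.cong₂ (λ y u → y +∞ [ + (u ℕ.* suc (B ℕ.+ B)) ]) (≉0⇒finite fe≉0) we≡0)
          (≡.cong [_] (ℤ.+-identityʳ _))
      , λ k k≢e → far (proj₁ (bound k)) (proj₂ (bound e)) (1≤w k k≢e) ℕ.≤-refl

    -- A large `v x` isolates the constant term, a very negative one the leading term.
    nonzero-value : ∀ f e → IsEnd e → ¬ lookup f e ≈ 0# →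
                    ∃[ x ] (¬ x ≈ 0#) × ¬ eval f x ≈ 0#
    nonzero-value f e (inj₁ ≡.refl) fe≉0 =
      let N , dom = far-from f toℕ e fe≉0 ≡.refl 0<toℕ
          x , vx≡N = v-surjective (+ N)
      in x , finite⇒≉0 vx≡N , eval≉0 f vx≡N (e , from-start (V f) N dom)
    nonzero-value f e (inj₂ ≡.refl) fe≉0 =
      let N , dom = far-from f (λ k → d ℕ.∸ toℕ k) e fe≉0 d∸d≡0 0<d∸toℕ
          x , vx≡N = v-surjective (ℤ.- + N)
      in x , finite⇒≉0 vx≡N , eval≉0 f vx≡N (e , from-end (V f) N dom)

    other-end : 0 ℕ.< d → ∀ j → ∃[ e ] IsEnd e × e ≢ j
    other-end 0<d j with zero Fin.≟ j
    ... | no 0≢j = zero , inj₁ ≡.refl , 0≢j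
    ... | yes ≡.refl = fromℕ d , inj₂ ≡.refl , λ eq →
      ℕ.<-irrefl (≡.trans (≡.sym (≡.cong toℕ eq)) (Fin.toℕ-fromℕ d)) 0<d

    wanda-finishes : 0 ℕ.< d → ∀ f j →
      (∀ k → IsEnd k → k ≢ j → ¬ lookup f k ≈ 0#) →
      ∃[ a ] (¬ a ≈ 0#) × HasRoot (f [ j ]≔ a)
    wanda-finishes 0<d f j ends with other-end 0<d j
    -- With the `j`-th coefficient set to `0#`, the value at `x` is the remainder `R`. Its being
    -- nonzero is what makes the final coefficient `- R * y` nonzero, hence legal even at an end.
    ... | e , isEnd , e≢j with nonzero-value (f [ j ]≔ 0#) e isEnd
          (ends e isEnd e≢j ∘ trans (reflexive (≡.sym (lookup∘update′ e≢j f 0#))))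
    ... | x , x≉0 , fx≉0 with inverse (x ^ toℕ j) xʲ≉0
      where
      xʲ≉0 : ¬ x ^ toℕ j ≈ 0#
      xʲ≉0 = finite⇒≉0 (v-^ (≉0⇒finite x≉0) (toℕ j))
    ... | y , y*xʲ≈1 , _ = a , a≉0 , x , root
      where
      R = remainder f j x
      a = - R * y
      a*xʲ≈-R : a * x ^ toℕ j ≈ - R
      a*xʲ≈-R = trans (*-assoc _ _ _) (trans (*-congˡ y*xʲ≈1) (*-identityʳ _))
      root : eval (f [ j ]≔ a) x ≈ 0#
      root = trans (eval-update f j a x) (trans (+-congʳ a*xʲ≈-R) (-‿inverseˡ R))
      a≉0 : ¬ a ≈ 0#
      a≉0 a≈0 = fx≉0 (trans (eval-update f j 0# x)
        (trans (+-congʳ (trans (*-congʳ (sym a≈0)) a*xʲ≈-R)) (-‿inverseˡ R)))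

    -- Only the two ends have finite values, and these can agree at an integral `n` only if `d`
    -- divides `δ - α`; otherwise the smaller one dominates.
    binomial-no-root : ∀ f → ¬ lookup f zero ≈ 0# → ¬ lookup f (fromℕ d) ≈ 0# →
      (∀ k → ¬ IsEnd k → lookup f k ≈ 0#) →
      ¬ + d ℤ.∣ finite (V f (fromℕ d)) ℤ.- finite (V f zero) → ¬ HasRoot f
    binomial-no-root f f₀≉0 fd≉0 middle ∤ = no-root f f₀≉0 λ n →
      compare n (ℤ.<-cmp α (δ ℤ.+ + d ℤ.* n))
      where
      α = finite (V f zero)
      δ = finite (V f (fromℕ d))
      U : ℤ → Fin (suc d) → ℤ ⁺
      U n k = V f k +∞ [ + toℕ k ℤ.* n ]
      U₀ : ∀ n → U n zero ≡ [ α ]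
      U₀ n = ≡.trans (≡.cong (_+∞ _) (≉0⇒finite f₀≉0)) (≡.cong [_]
        (≡.trans (≡.cong (λ u → α ℤ.+ u) (ℤ.*-zeroˡ n)) (ℤ.+-identityʳ α)))
      Ud : ∀ n → U n (fromℕ d) ≡ [ δ ℤ.+ + d ℤ.* n ]
      Ud n = ≡.cong₂ (λ y k → y +∞ [ + k ℤ.* n ]) (≉0⇒finite fd≉0) (Fin.toℕ-fromℕ d)
      others : ∀ n k {m} → k ≢ zero → k ≢ fromℕ d → m ≤⁺ U n k
      others n k k≢0 k≢d = ≡.subst (_ ≤⁺_)
        (≡.cong (_+∞ [ + toℕ k ℤ.* n ]) (≡.sym (v-0 (middle k [ k≢0 , k≢d ]′)))) (_ ≤⊤⁺)
      compare : ∀ n → _ → ∃ (Dominates (U n))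
      compare n (tri≈ _ eq _) = contradiction
        (divides (ℤ.- n) (≡.trans (≡.cong (λ u → δ ℤ.- u) eq) (cancel δ (+ d) n))) ∤
        where
        cancel : ∀ δ d n → δ ℤ.- (δ ℤ.+ d ℤ.* n) ≡ ℤ.- n ℤ.* d
        cancel = solve-∀
      compare n (tri< lt _ _) = zero , α , U₀ n , λ k k≢0 → case k k≢0 (k Fin.≟ fromℕ d)
        where
        case : ∀ k → k ≢ zero → Dec (k ≡ fromℕ d) → [ ℤ.suc α ] ≤⁺ U n k
        case k _   (yes ≡.refl) = ≡.subst ([ ℤ.suc α ] ≤⁺_) (≡.sym (Ud n)) [ ℤ.i<j⇒suc[i]≤j lt ]
        case k k≢0 (no k≢d)     = others n k k≢0 k≢d
      compare n (tri> _ _ gt) = fromℕ d , _ , Ud n , λ k k≢d → case k k≢d (k Fin.≟ zero)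
        where
        case : ∀ k → k ≢ fromℕ d → Dec (k ≡ zero) → [ ℤ.suc (δ ℤ.+ + d ℤ.* n) ] ≤⁺ U n k
        case k _   (yes ≡.refl) = ≡.subst ([ ℤ.suc (δ ℤ.+ + d ℤ.* n) ] ≤⁺_) (≡.sym (U₀ n)) [ ℤ.i<j⇒suc[i]≤j gt ]
        case k k≢d (no k≢0)     = others n k k≢0 k≢d

-- Rootless cubics over a finite residue field.

-- Pigeonhole: without z, only q - 1 indices i are left to reach q values t.
unreached : ∀ {q r} {R : Fin q → Fin q → Set r} → (∀ t i → Dec (R t i)) →
  ∀ z → (∀ t → ¬ R t z) → (∀ {t t′ i} → R t i → R t′ i → t ≡ t′) →
  ∃[ t ] ∀ i → ¬ R t i
unreached {suc q} {R = R} R? z misses functional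
  with Fin.any? (λ t → Fin.all? (λ i → ¬? (R? t i)))
... | yes found = found
-- If each `t` had an index, these indices would be distinct by `functional` and different from `z`;
-- deleting `z` would inject `Fin (suc q)` into `Fin q`.
... | no none = ⊥-elim (Fin.<⇒notInjective {f = λ t → punchOut (z≢g t)} ℕ.≤-refl g′-injective)
  where
  reached : ∀ t → ∃ (R t)
  reached t = decidable-stable (Fin.any? (R? t)) λ ¬reached →
    none (t , λ i Rti → ¬reached (i , Rti))
  g : Fin (suc q) → Fin (suc q)
  g t = proj₁ (reached t)
  z≢g : ∀ t → z ≢ g t
  z≢g t eq = misses t (≡.subst (R t) (≡.sym eq) (proj₂ (reached t)))
  g′-injective : ∀ {t t′} → punchOut (z≢g t) ≡ punchOut (z≢g t′) → t ≡ t′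
  g′-injective {t} {t′} eq = functional (proj₂ (reached t))
    (≡.subst (R t′) (≡.sym (Fin.punchOut-injective (z≢g t) (z≢g t′) eq)) (proj₂ (reached t′)))

module _ {c ℓ : Level} (K : Field c ℓ) (𝓥 : DiscreteValuation K) where
  open Field K hiding (zero)
  open DiscreteValuation 𝓥

  -- Representatives of the residue classes, taken in `K` itself; congruence modulo 𝔪 is expressed
  -- as a difference of value at least 1.
  record ResidueSystem : Set (c ⊔ ℓ) where
    field
      size       : ℕ
      rep        : Fin size → Carrier
      integral   : ∀ i → [ 0ℤ ] ≤⁺ v (rep i)
      injective  : ∀ i j → [ 1ℤ ] ≤⁺ v (rep i - rep j) → i ≡ j
      surjective : ∀ {y} → [ 0ℤ ] ≤⁺ v y → ∃[ i ] [ 1ℤ ] ≤⁺ v (rep i - y)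

module Cubic {c ℓ : Level} (K : Field c ℓ) (𝓥 : DiscreteValuation K)
             (residues : ResidueSystem K 𝓥) where
  open Field K hiding (zero)
  open DiscreteValuation 𝓥
  open RingProperties ring using (-0#≈0#)
  open ResidueSystem residues
  open Valued K 𝓥
  open Game K 3 using (Polynomial; eval; HasRoot)
  open Polynomials 3
  open SetoidReasoning setoid
  open SemiringSolver commutativeSemiring using (solve; _:=_; _:+_; _:*_)

  ¬1≤0 : ∀ {n x} → v x ≡ [ 0ℤ ] → ¬ [ + suc n ] ≤⁺ v x
  ¬1≤0 eq p with +≤+ () ← [≤]-injective (≡.subst (_ ≤⁺_) eq p)

  unit : ∀ {x} → [ 0ℤ ] ≤⁺ v x → ¬ [ 1ℤ ] ≤⁺ v x → v x ≡ [ 0ℤ ]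
  unit {x} 0≤ ¬1≤ with v x | 0≤ | ¬1≤
  ... | ⊤⁺          | _       | ¬p = contradiction (_ ≤⊤⁺) ¬p
  ... | [ + zero ]  | _       | _  = ≡.refl
  ... | [ + suc n ] | _       | ¬p = contradiction [ +≤+ (s≤s z≤n) ] ¬p
  ... | [ -[1+ n ] ] | [ () ] | _

  x+[y-x]≈y : ∀ x y → x + (y - x) ≈ y
  x+[y-x]≈y x y = trans (+-comm x _) (trans (+-assoc y _ x)
    (trans (+-congˡ (-‿inverseˡ x)) (+-identityʳ y)))

  v≥-difference : ∀ {k x y z} → x ≈ y + z → k ≤⁺ v x → k ≤⁺ v y → k ≤⁺ v z
  v≥-difference {x = x} {y} {z} eq p q = v≥-resp
    (trans (+-congʳ eq) (trans (+-congʳ (+-comm y z)) (trans (+-assoc z y _)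
      (trans (+-congˡ (-‿inverseʳ y)) (+-identityʳ z)))))
    (v≥-+ p (v≥-neg q))

  monic : Carrier → Carrier → Carrier → Carrier
  monic e t y = e + (t * (y * y) + y * (y * y))

  monic-cong : ∀ {e e′ t t′ y y′} → e ≈ e′ → t ≈ t′ → y ≈ y′ → monic e t y ≈ monic e′ t′ y′
  monic-cong p q r = +-cong p (+-cong (*-cong q (*-cong r r)) (*-cong r (*-cong r r)))

  -- The change is a multiple of `h`, so integral arguments that are congruent modulo 𝔪 give
  -- congruent values.
  monic-shift : ∀ e t y h → monic e t (y + h) ≈
    monic e t y + h * (t * (y + (y + h)) + ((y + h) * (y + h) + ((y + h) * y + y * y)))
  monic-shift = solve 4 (λ e t y h →
    e :+ (t :* ((y :+ h) :* (y :+ h)) :+ (y :+ h) :* ((y :+ h) :* (y :+ h))) :=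
    (e :+ (t :* (y :* y) :+ y :* (y :* y))) :+
    h :* (t :* (y :+ (y :+ h)) :+ ((y :+ h) :* (y :+ h) :+ ((y :+ h) :* y :+ y :* y)))) refl

  -- The dependence on `t` is linear with slope `r * r`, so a root `r` modulo 𝔪 that is a unit
  -- determines `t` modulo 𝔪.
  monic-linear : ∀ e t D r → monic e (t + D) r ≈ monic e t r + D * (r * r)
  monic-linear = solve 4 (λ e t D r →
    e :+ ((t :+ D) :* (r :* r) :+ r :* (r :* r)) :=
    (e :+ (t :* (r :* r) :+ r :* (r :* r))) :+ D :* (r :* r)) refl

  -- If `v y ≥ 1`, the other two terms cannot cancel the unit `e`. If `v y = n < 0`, the cube has
  -- value `3n`, while the other terms have value at least `2n`.
  monic-root-unit : ∀ {e t y} → v e ≡ [ 0ℤ ] → [ 0ℤ ] ≤⁺ v t → monic e t y ≈ 0# → v y ≡ [ 0ℤ ]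
  monic-root-unit {e} {t} {y} ve≡0 0≤t root = unit 0≤y ¬1≤y
    where
    e≈ : e ≈ - (t * (y * y) + y * (y * y))
    e≈ = ≈-neg root
    y³≈ : y * (y * y) ≈ - (e + t * (y * y))
    y³≈ = ≈-neg (trans (+-comm _ _) (trans (+-assoc e _ _) root))
    ¬1≤y : ¬ [ 1ℤ ] ≤⁺ v y
    ¬1≤y p = ¬1≤0 ve≡0 (v≥-resp (sym e≈) (v≥-neg (v≥-+ (v≥-* 0≤t (v≥-* p p))
      (≤⁺-trans ℤ.≤-trans [ +≤+ (s≤s (s≤s z≤n)) ] (v≥-* p (v≥-* p p))))))
    0≤y : [ 0ℤ ] ≤⁺ v y
    0≤y with v y in vy≡
    ... | ⊤⁺      = _ ≤⊤⁺
    ... | [ + n ] = [ +≤+ z≤n ]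
    ... | [ n@(-[1+ _ ]) ] = contradiction
      ([≤]-injective (≡.subst (_ ≤⁺_) vy³≡ (v≥-resp (sym y³≈) (v≥-neg (v≥-+
        (≡.subst (_ ≤⁺_) (≡.sym ve≡0) [ ℤ.-≤+ ]) (v≥-* 0≤t (v≥-* n≤y n≤y)))))))
      (ℤ.<⇒≱ (ℤ.+-monoˡ-< (n ℤ.+ n) (ℤ.-<+ {n = 0})))
      where
      n≤y : [ n ] ≤⁺ v y
      n≤y = ≡.subst ([ n ] ≤⁺_) (≡.sym vy≡) [ ℤ.≤-refl ]
      vy³≡ : v (y * (y * y)) ≡ [ n ℤ.+ (n ℤ.+ n) ]
      vy³≡ = ≡.trans (v-* y _) (≡.cong₂ _+∞_ vy≡ (≡.trans (v-* y y) (≡.cong₂ _+∞_ vy≡ vy≡)))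

  -- y ↦ - (e + y³) / y² has fewer than q arguments among the q residue classes.
  rootless-monic : ∀ e → v e ≡ [ 0ℤ ] → ∃[ t ] ∀ y → ¬ monic e t y ≈ 0#
  rootless-monic e ve≡0 with surjective {0#} v≥-0
  -- `z` is the class of 0, which no `t` hits because a hit requires a unit.
  ... | z , 1≤ρz-0 with unreached {R = Hit} Hit? z misses functional
    where
    Hit : Fin size → Fin size → Set
    Hit t i = v (rep i) ≡ [ 0ℤ ] × [ 1ℤ ] ≤⁺ v (monic e (rep t) (rep i))
    Hit? : ∀ t i → Dec (Hit t i)
    Hit? t i = ≡-dec ℤ._≟_ (v (rep i)) [ 0ℤ ] ×-dec ≤⁺-dec ℤ._≤?_ [ 1ℤ ] (v (monic e (rep t) (rep i)))
    misses : ∀ t → ¬ Hit t z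
    misses t (unit-z , _) = ¬1≤0 unit-z
      (v≥-resp (trans (+-congˡ -0#≈0#) (+-identityʳ _)) 1≤ρz-0)
    functional : ∀ {t t′ i} → Hit t i → Hit t′ i → t ≡ t′
    functional {t} {t′} {i} (u , p) (_ , p′) = injective t t′ (≡.subst ([ 1ℤ ] ≤⁺_) vDrr≡
      (v≥-difference (trans (monic-cong refl (sym (x+[y-x]≈y (rep t′) (rep t))) refl)
        (monic-linear e (rep t′) D r)) p p′))
      where
      r = rep i
      D = rep t - rep t′
      +0 : ∀ x → x +∞ [ 0ℤ ] ≡ x
      +0 ⊤⁺    = ≡.refl
      +0 [ n ] = ≡.cong [_] (ℤ.+-identityʳ n)
      vDrr≡ : v (D * (r * r)) ≡ v D
      vDrr≡ = ≡.trans (v-* D _) (≡.trans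
        (≡.cong (v D +∞_) (≡.trans (v-* r r) (≡.cong₂ _+∞_ u u))) (+0 (v D)))
  ... | t , ¬hit = rep t , λ y root → no-root-y y root (monic-root-unit ve≡0 (integral t) root)
    where
    no-root-y : ∀ y → monic e (rep t) y ≈ 0# → ¬ v y ≡ [ 0ℤ ]
    no-root-y y root vy≡0 with surjective {y} (≡.subst ([ 0ℤ ] ≤⁺_) (≡.sym vy≡0) [ ℤ.≤-refl ])
    -- A root `y` would make its representative `rep i` a unit root modulo 𝔪, hence a hit for the
    -- unreached `t`.
    ... | i , 1≤h = ¬hit i (unit 0≤r ¬1≤r , v≥-resp (sym shifted) 1≤rest)
      where
      r = rep i
      h = r - y
      0≤r = integral i
      r≈ : y + h ≈ r
      r≈ = x+[y-x]≈y y r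
      0≤y : [ 0ℤ ] ≤⁺ v y
      0≤y = ≡.subst ([ 0ℤ ] ≤⁺_) (≡.sym vy≡0) [ ℤ.≤-refl ]
      0≤y+h : [ 0ℤ ] ≤⁺ v (y + h)
      0≤y+h = v≥-resp (sym r≈) 0≤r
      ¬1≤r : ¬ [ 1ℤ ] ≤⁺ v r
      ¬1≤r p = ¬1≤0 vy≡0 (v≥-difference (trans (sym r≈) (+-comm y h)) p 1≤h)
      cofactor = rep t * (y + (y + h)) + ((y + h) * (y + h) + ((y + h) * y + y * y))
      shifted : monic e (rep t) r ≈ h * cofactor
      shifted = trans (monic-cong refl refl (sym r≈)) (trans (monic-shift e (rep t) y h)
        (trans (+-congʳ root) (+-identityˡ _)))
      1≤rest : [ 1ℤ ] ≤⁺ v (h * cofactor)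
      1≤rest = v≥-* 1≤h (v≥-+ (v≥-* (integral t) (v≥-+ 0≤y 0≤y+h))
        (v≥-+ (v≥-* 0≤y+h 0≤y+h) (v≥-+ (v≥-* 0≤y+h 0≤y) (v≥-* 0≤y 0≤y))))

  -- The leading coefficient `a * s³` that appears on substituting `x = s * y`; dividing by it makes
  -- the cubic monic.
  scaled : Carrier → Carrier → Carrier
  scaled a s = a * (s * (s * s))

  expand : ∀ e a s t y →
    e * scaled a s + (a * (s * t) * (s * y * (s * y)) + a * (s * y * (s * y * (s * y))))
    ≈ scaled a s * monic e t y
  expand = solve 5 (λ e a s t y →
    e :* (a :* (s :* (s :* s))) :+
    (a :* (s :* t) :* (s :* y :* (s :* y)) :+ a :* (s :* y :* (s :* y :* (s :* y)))) :=
    a :* (s :* (s :* s)) :* (e :+ (t :* (y :* y) :+ y :* (y :* y)))) refl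

  eval-rescaled : ∀ {a₀ a₁ a₃ e s t x y} → a₁ ≈ 0# → a₀ ≈ e * scaled a₃ s → x ≈ s * y →
    eval (a₀ ∷ a₁ ∷ a₃ * (s * t) ∷ a₃ ∷ []) x ≈ scaled a₃ s * monic e t y
  eval-rescaled {a₀} {a₁} {a₃} {e} {s} {t} {x} {y} a₁≈0 a₀≈ x≈ = begin
    eval (a₀ ∷ a₁ ∷ a₃ * (s * t) ∷ a₃ ∷ []) x
      ≈⟨ +-cong (*-identityʳ a₀) (+-cong (trans (*-congʳ a₁≈0) (zeroˡ _))
          (+-cong (*-congˡ (*-congˡ (*-identityʳ x)))
            (trans (+-identityʳ _) (*-congˡ (*-congˡ (*-congˡ (*-identityʳ x))))))) ⟩
    a₀ + (0# + (a₃ * (s * t) * (x * x) + a₃ * (x * (x * x))))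
      ≈⟨ +-congˡ (+-identityˡ _) ⟩
    a₀ + (a₃ * (s * t) * (x * x) + a₃ * (x * (x * x)))
      ≈⟨ +-cong a₀≈ (+-cong (*-congˡ (*-cong x≈ x≈)) (*-congˡ (*-cong x≈ (*-cong x≈ x≈)))) ⟩
    e * scaled a₃ s + (a₃ * (s * t) * (s * y * (s * y)) + a₃ * (s * y * (s * y * (s * y))))
      ≈⟨ expand e a₃ s t y ⟩
    scaled a₃ s * monic e t y ∎

  divide : ∀ {y} → ¬ y ≈ 0# → ∀ x → ∃[ e ] x ≈ e * y
  divide {y} y≉0 x = let y⁻¹ , y⁻¹y≈1 , _ = inverse y y≉0 in
    x * y⁻¹ , sym (trans (*-assoc _ _ _) (trans (*-congˡ y⁻¹y≈1) (*-identityʳ x)))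

  divide-unit : ∀ {x y n} → v x ≡ [ n ] → v y ≡ [ n ] → ∃[ e ] x ≈ e * y × v e ≡ [ 0ℤ ]
  divide-unit {x} {y} {n} vx≡n vy≡n =
    let e , x≈ey = divide (finite⇒≉0 vy≡n) x in
    e , x≈ey , unit-cancel (v e) (≡.trans (≡.cong (v e +∞_) (≡.sym vy≡n))
      (≡.trans (≡.sym (≡.trans (v-cong x≈ey) (v-* e y))) vx≡n))
    where
    cancel : ∀ m n → m ≡ m ℤ.+ n ℤ.- n
    cancel = solve-∀
    unit-cancel : ∀ z → z +∞ [ n ] ≡ [ n ] → z ≡ [ 0ℤ ]
    unit-cancel [ m ] eq = ≡.cong [_] (≡.trans (cancel m n)
      (≡.trans (≡.cong (ℤ._- n) ([]-injective eq)) (ℤ.+-inverseʳ n)))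

  *-cancelˡ-0 : ∀ {x y} → ¬ x ≈ 0# → x * y ≈ 0# → y ≈ 0#
  *-cancelˡ-0 {x} {y} x≉0 xy≈0 = let x⁻¹ , x⁻¹x≈1 , _ = inverse x x≉0 in begin
    y              ≈⟨ *-identityˡ y ⟨
    1# * y         ≈⟨ *-congʳ x⁻¹x≈1 ⟨
    x⁻¹ * x * y    ≈⟨ *-assoc _ _ _ ⟩
    x⁻¹ * (x * y)  ≈⟨ *-congˡ xy≈0 ⟩
    x⁻¹ * 0#       ≈⟨ zeroʳ _ ⟩
    0#             ∎

  v-scaled : ∀ {a s m n} → v a ≡ [ m ] → v s ≡ [ n ] → v (scaled a s) ≡ [ m ℤ.+ (n ℤ.+ (n ℤ.+ n)) ]
  v-scaled va vs = ≡.trans (v-* _ _) (≡.cong₂ _+∞_ va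
    (≡.trans (v-* _ _) (≡.cong₂ _+∞_ vs (≡.trans (v-* _ _) (≡.cong₂ _+∞_ vs vs)))))

  -- Every `x` has the form `s * y`, so a root of the cubic would yield a root of its monic
  -- rescaling.
  rescaled-no-root : ∀ {a₀ a₁ a₃ e s t} → ¬ s ≈ 0# → ¬ scaled a₃ s ≈ 0# → a₁ ≈ 0# →
    a₀ ≈ e * scaled a₃ s → (∀ y → ¬ monic e t y ≈ 0#) →
    ¬ HasRoot (a₀ ∷ a₁ ∷ a₃ * (s * t) ∷ a₃ ∷ [])
  rescaled-no-root s≉0 l≉0 a₁≈0 a₀≈el rootless (x , root) with divide s≉0 x
  ... | y , x≈ys = rootless y (*-cancelˡ-0 l≉0
    (trans (sym (eval-rescaled a₁≈0 a₀≈el (trans x≈ys (*-comm y _)))) root))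

  rootless-rescaled : ∀ a₀ a₁ a₃ e s → ¬ s ≈ 0# → ¬ scaled a₃ s ≈ 0# → a₁ ≈ 0# →
    a₀ ≈ e * scaled a₃ s → v e ≡ [ 0ℤ ] → ∃[ a ] ¬ HasRoot (a₀ ∷ a₁ ∷ a ∷ a₃ ∷ [])
  rootless-rescaled a₀ a₁ a₃ e s s≉0 l≉0 a₁≈0 a₀≈el ve≡0 =
    conclude (rootless-monic e ve≡0)
    where
    conclude : ∃[ t ] (∀ y → ¬ monic e t y ≈ 0#) → ∃[ a ] ¬ HasRoot (a₀ ∷ a₁ ∷ a ∷ a₃ ∷ [])
    conclude (t , rootless) = a₃ * (s * t) ,
      rescaled-no-root {a₀} {a₁} {a₃} {e} {s} {t} s≉0 l≉0 a₁≈0 a₀≈el rootless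

  -- With `δ - α = 3k`, an `s` of value `- k` gives `a₃ * s³` the value `δ - 3k = α`, so the
  -- constant term of the rescaled cubic is a unit.
  rootless-aligned : ∀ a₀ a₁ a₃ {α δ} → v a₀ ≡ [ α ] → v a₃ ≡ [ δ ] → a₁ ≈ 0# →
    + 3 ℤ.∣ δ ℤ.- α → ∃[ a ] ¬ HasRoot (a₀ ∷ a₁ ∷ a ∷ a₃ ∷ [])
  rootless-aligned a₀ a₁ a₃ {α} {δ} va₀≡α va₃≡δ a₁≈0 (divides k δ-α≡3k) =
    scale (v-surjective (ℤ.- k))
    where
    regroup : ∀ d a k → d ℤ.+ (ℤ.- k ℤ.+ (ℤ.- k ℤ.+ ℤ.- k)) ≡ d ℤ.- a ℤ.- k ℤ.* + 3 ℤ.+ a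
    regroup = solve-∀
    cancel : ∀ k a → k ℤ.- k ℤ.+ a ≡ a
    cancel = solve-∀
    slope : δ ℤ.+ (ℤ.- k ℤ.+ (ℤ.- k ℤ.+ ℤ.- k)) ≡ α
    slope = ≡.trans (regroup δ α k)
      (≡.trans (≡.cong (λ u → u ℤ.- k ℤ.* + 3 ℤ.+ α) δ-α≡3k) (cancel (k ℤ.* + 3) α))
    scale : ∃[ s ] v s ≡ [ ℤ.- k ] → ∃[ a ] ¬ HasRoot (a₀ ∷ a₁ ∷ a ∷ a₃ ∷ [])
    scale (s , vs≡-k) = divided (divide-unit va₀≡α vl≡α)
      where
      vl≡α : v (scaled a₃ s) ≡ [ α ]
      vl≡α = ≡.trans (v-scaled {a₃} {s} va₃≡δ vs≡-k) (≡.cong [_] slope)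
      divided : ∃[ e ] a₀ ≈ e * scaled a₃ s × v e ≡ [ 0ℤ ] →
                ∃[ a ] ¬ HasRoot (a₀ ∷ a₁ ∷ a ∷ a₃ ∷ [])
      divided (e , a₀≈el , ve≡0) = rootless-rescaled a₀ a₁ a₃ e s
        (finite⇒≉0 vs≡-k) (finite⇒≉0 vl≡α) a₁≈0 a₀≈el ve≡0

  -- With `a₁ = a₂ = 0` the single edge of the Newton polygon has integral slope exactly when 3
  -- divides the difference of the end values. If it does not, `a₂ = 0#` already wins; if it does,
  -- rescaling applies.
  rootless-cubic : ∀ f → ¬ lookup f zero ≈ 0# → ¬ lookup f (fromℕ 3) ≈ 0# →
    lookup f (suc zero) ≈ 0# → ∃[ a ] ¬ HasRoot (f [ 2F ]≔ a)
  rootless-cubic (a₀ ∷ a₁ ∷ a₂ ∷ a₃ ∷ []) a₀≉0 a₃≉0 a₁≈0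
    with + 3 ℤ.∣? finite (v a₃) ℤ.- finite (v a₀)
  ... | yes 3∣ = rootless-aligned a₀ a₁ a₃ (≉0⇒finite a₀≉0) (≉0⇒finite a₃≉0) a₁≈0 3∣
  ... | no  3∤ = 0# , binomial-no-root (a₀ ∷ a₁ ∷ 0# ∷ a₃ ∷ []) a₀≉0 a₃≉0 middle 3∤
    where
    middle : ∀ k → ¬ IsEnd k → lookup (a₀ ∷ a₁ ∷ 0# ∷ a₃ ∷ []) k ≈ 0#
    middle zero                   k-mid = contradiction (inj₁ ≡.refl) k-mid
    middle (suc zero)             _     = a₁≈0
    middle (suc (suc zero))       _     = refl
    middle (suc (suc (suc zero))) k-mid = contradiction (inj₂ ≡.refl) k-mid

-- Residue representatives from the discrete valuation ring.

module _ {c ℓ c′ ℓ′ : Level} {O : CommutativeRing c ℓ} {K : Field c′ ℓ′}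
  {ι : CommutativeRing.Carrier O → Field.Carrier K} {frac : IsFractionField O K ι}
  (dvr : IsDiscreteValuationRing frac) where

  open IsDiscreteValuationRing dvr
  open Valued K discreteValuation using (v≥-resp)
  private
    module O = CommutativeRing O
    module K = Field K
    module F = IsFractionField frac

  residue-system : HasFiniteResidueField dvr → ResidueSystem K discreteValuation
  residue-system (q , bij) = record
    { size       = q
    ; rep        = ι ∘ to
    ; integral   = λ i → Equivalence.from (integral _) (to i , K.refl)
    ; injective  = λ i j p → injective (v≥-resp (K.sym (ι-- (to i) (to j))) p)
    ; surjective = λ {y} 0≤y → let a , ιa≈y = Equivalence.to (integral y) 0≤y
                                   i , to-i = surjective a
        in i , v≥-resp (K.trans (ι-- (to i) a) (K.+-congˡ (K.-‿cong ιa≈y))) (to-i ≡.refl)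
    }
    where
    open Bijection bij using (to; injective; surjective)
    ι-- : ∀ a b → ι (a O.- b) K.≈ ι a K.- ι b
    ι-- a b = K.trans (F.+-homo _ _) (K.+-congˡ (F.-‿homo b))

-- Players and the number of open coefficients.

_≟ᴾ_ : (s t : Player) → Dec (s ≡ t)
nora  ≟ᴾ nora  = yes ≡.refl
nora  ≟ᴾ wanda = no λ ()
wanda ≟ᴾ nora  = no λ ()
wanda ≟ᴾ wanda = yes ≡.refl

≢⇒opponent≡ : ∀ {s t} → s ≢ t → opponent s ≡ t
≢⇒opponent≡ {nora}  {nora}  s≢t = contradiction ≡.refl s≢t
≢⇒opponent≡ {nora}  {wanda} s≢t = ≡.refl
≢⇒opponent≡ {wanda} {nora}  s≢t = ≡.refl
≢⇒opponent≡ {wanda} {wanda} s≢t = contradiction ≡.refl s≢t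

nothing≢just : ∀ {a} {A : Set a} {m : Maybe A} {x} → m ≡ nothing → m ≢ just x
nothing≢just ≡.refl ()

module _ {a} {A : Set a} where

  #open : ∀ {n} → Vec (Maybe A) n → ℕ
  #open []            = 0
  #open (just _ ∷ p)  = #open p
  #open (nothing ∷ p) = suc (#open p)

  #open-update : ∀ {n} (p : Vec (Maybe A) n) i x →
                 lookup p i ≡ nothing → #open p ≡ suc (#open (p [ i ]≔ just x))
  #open-update (nothing ∷ p) zero    x _  = ≡.refl
  #open-update (just _ ∷ p)  (suc i) x eq = #open-update p i x eq
  #open-update (nothing ∷ p) (suc i) x eq = ≡.cong suc (#open-update p i x eq)

  #open-positive : ∀ {n k} (p : Vec (Maybe A) n) → #open p ≡ suc k → ∃[ i ] lookup p i ≡ nothing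
  #open-positive (nothing ∷ p) _  = zero , ≡.refl
  #open-positive (just _ ∷ p)  eq = let i , eq′ = #open-positive p eq in suc i , eq′

  #open-zero : ∀ {n} (p : Vec (Maybe A) n) → #open p ≡ 0 → ∃[ f ] p ≡ map just f
  #open-zero []           _  = [] , ≡.refl
  #open-zero (just x ∷ p) eq = let f , eq′ = #open-zero p eq in x ∷ f , ≡.cong (just x ∷_) eq′

  #open-replicate : ∀ n → #open (replicate n nothing) ≡ n
  #open-replicate zero    = ≡.refl
  #open-replicate (suc n) = ≡.cong suc (#open-replicate n)

-- Strategies from arbitrary positions.

module Playing {c ℓ : Level} (K : Field c ℓ) (d : ℕ) where
  open Field K hiding (zero)
  open Game K d

  Wins : (P t : Player) → Position → Set (c ⊔ ℓ)
  Wins P t p = Σ (Strategy P t p) Winning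

  NonzeroEnds : Position → Set (c ⊔ ℓ)
  NonzeroEnds p = ∀ k a → IsEnd k → lookup p k ≡ just a → ¬ a ≈ 0#

  -- n + 1 moves remain, and P makes the last one.
  record Turn (P : Player) (n : ℕ) (t : Player) (p : Position) : Set (c ⊔ ℓ) where
    field
      moves-left   : #open p ≡ suc n
      last-is      : mover t n ≡ P
      nonzero-ends : NonzeroEnds p
  open Turn

  infix 4 _⊑_
  -- Chosen coefficients are never changed, so what is arranged early in the game still holds at the
  -- last move.
  _⊑_ : Position → Position → Set c
  p ⊑ q = ∀ k a → lookup p k ≡ just a → lookup q k ≡ just a

  play-⊑ : ∀ p m → p ⊑ play p m
  play-⊑ p m k a pk≡a with k Fin.≟ Move.index m
  ... | yes ≡.refl = contradiction pk≡a (nothing≢just (Move.open′ m))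
  ... | no k≢i     = ≡.trans (lookup∘update′ k≢i p _) pk≡a

  play-turn : ∀ {P n t p} → Turn P (suc n) t p → (m : Move p) → Turn P n (opponent t) (play p m)
  play-turn {p = p} s m = record
    { moves-left   = ℕ.suc-injective
        (≡.trans (≡.sym (#open-update p index value open′)) (moves-left s))
    ; last-is      = last-is s
    ; nonzero-ends = nonzero
    }
    where
    open Move m
    nonzero : NonzeroEnds (play p m)
    nonzero k a end eq with k Fin.≟ index
    ... | yes ≡.refl = ≡.subst (λ b → ¬ b ≈ 0#)
      (just-injective (≡.trans (≡.sym (lookup∘update index p _)) eq)) (legal end)
    ... | no k≢i = nonzero-ends s k a end (≡.trans (≡.sym (lookup∘update′ k≢i p _)) eq)

  start-turn : ∀ first → Turn (lastMover first d) d first start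
  start-turn first = record
    { moves-left   = #open-replicate (suc d)
    ; last-is      = ≡.refl
    ; nonzero-ends = λ k a _ eq → contradiction eq (nothing≢just (lookup-replicate k nothing))
    }

  choosing : ∀ {P n t p} → t ≡ P → Turn P (suc n) t p →
             ∀ k a → (IsEnd k → ¬ a ≈ 0#) → lookup p k ≡ nothing →
             (let q = p [ k ]≔ just a in
              Turn P n (opponent t) q → p ⊑ q → lookup q k ≡ just a → Wins P (opponent t) q) →
             Wins P t p
  choosing {p = p} t≡P s k a legal open′ next =
    let m = record { index = k ; open′ = open′ ; value = a ; legal = legal }
        strategy , wins = next (play-turn s m) (play-⊑ p m) (lookup∘update k p (just a))
    in choose t≡P m strategy , wins

  awaiting : ∀ {P n t p} → t ≢ P → Turn P (suc n) t p →
             (∀ q → Turn P n (opponent t) q → p ⊑ q → Wins P (opponent t) q) → Wins P t p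
  awaiting {p = p} t≢P s next =
    await t≢P (#open-positive p (moves-left s)) (λ m → proj₁ (reply m)) , λ m → proj₂ (reply m)
    where
    reply : ∀ m → Wins _ _ (play p m)
    reply m = next (play p m) (play-turn s m) (play-⊑ p m)

  Filled : Position → Fin (suc d) → Set c
  Filled p k = ∃[ a ] lookup p k ≡ just a

  filled? : ∀ p k → Filled p k ⊎ lookup p k ≡ nothing
  filled? p k with lookup p k
  ... | just a  = inj₁ (a , ≡.refl)
  ... | nothing = inj₂ ≡.refl

  -- `P` takes coefficient `k` at the first opportunity unless the opponent gets there first,
  -- perhaps with another value; hence only `Filled` is promised. This costs at most two moves, so
  -- at least `n + 1` of the `n + 3` remain.
  fill : ∀ {P t p} k a → (IsEnd k → ¬ a ≈ 0#) → ∀ n → Turn P (suc (suc n)) t p →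
         (∀ {n′ t′ q} → n ℕ.≤ n′ → Turn P n′ t′ q → p ⊑ q → Filled q k → Wins P t′ q) →
         Wins P t p
  fill {P} {t} {p} k a legal n s next with t ≟ᴾ P | filled? p k
  ... | _       | inj₁ p-filled = next (ℕ.m≤n+m n 2) s (λ _ _ eq → eq) p-filled
  ... | yes t≡P | inj₂ open′ = choosing t≡P s k a legal open′ λ s′ p⊑q qk →
    next (ℕ.m≤n+m n 1) s′ p⊑q (a , qk)
  ... | no  t≢P | _ = awaiting t≢P s λ q s′ p⊑q → reply q s′ p⊑q (filled? q k)
    where
    reply : ∀ q → Turn P (suc n) (opponent t) q → p ⊑ q →
            Filled q k ⊎ lookup q k ≡ nothing → Wins P (opponent t) q
    reply q s′ p⊑q (inj₁ q-filled) = next (ℕ.m≤n+m n 1) s′ p⊑q q-filled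
    reply q s′ p⊑q (inj₂ open′)    = choosing (≢⇒opponent≡ t≢P) s′ k a legal open′ λ s″ q⊑r rk →
      next ℕ.≤-refl s″ (λ i b → q⊑r i b ∘ p⊑q i b) (a , rk)

  -- f extends p to every coefficient but the j-th, where its entry is arbitrary.
  Completion : Position → Polynomial → Fin (suc d) → Set c
  Completion p f j = ∀ k a → lookup p k ≡ just a → k ≢ j × lookup f k ≡ a

  Finishes : Player → Polynomial → Fin (suc d) → Set (c ⊔ ℓ)
  Finishes P f j = (∀ k → IsEnd k → k ≢ j → ¬ lookup f k ≈ 0#) →
                   ∃[ a ] (IsEnd j → ¬ a ≈ 0#) × WonBy P (f [ j ]≔ a)

  -- Until the last move `P` may play `1#` anywhere, which is legal even at the ends. Only the
  -- coefficients already chosen in `p` are remembered, and the last move alone has to win.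
  play-out : ∀ {P} n {t p} → Turn P n t p → (∀ f j → Completion p f j → Finishes P f j) → Wins P t p
  play-out zero {t} {p} s finishes with #open-positive p (moves-left s)
  -- The placeholder `0#` turns the position into a polynomial `f`; the last move overwrites it.
  ... | j , open′ with #open-zero (p [ j ]≔ just 0#)
          (ℕ.suc-injective (≡.trans (≡.sym (#open-update p j 0# open′)) (moves-left s)))
  ... | f , p≡f = finish (finishes f j completion ends)
    where
    lookup-f : ∀ k → k ≢ j → lookup p k ≡ just (lookup f k)
    lookup-f k k≢j = ≡.trans (≡.sym (lookup∘update′ k≢j p (just 0#)))
      (≡.trans (≡.cong (λ q → lookup q k) p≡f) (lookup-map k just f))
    completion : Completion p f j
    completion k a pk≡a = k≢j , just-injective (≡.trans (≡.sym (lookup-f k k≢j)) pk≡a)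
      where
      k≢j : k ≢ j
      k≢j ≡.refl = nothing≢just open′ pk≡a
    ends : ∀ k → IsEnd k → k ≢ j → ¬ lookup f k ≈ 0#
    ends k end k≢j = nonzero-ends s k (lookup f k) end (lookup-f k k≢j)
    finish : ∃[ a ] (IsEnd j → ¬ a ≈ 0#) × WonBy _ (f [ j ]≔ a) → Wins _ t p
    finish (a , legal , won) = choose (last-is s)
      (record { index = j ; open′ = open′ ; value = a ; legal = legal })
      (finished (f [ j ]≔ a) (≡.trans (≡.sym ([]≔-idempotent p j))
        (≡.trans (≡.cong (_[ j ]≔ just a) p≡f) (≡.sym (map-[]≔ just f j))))) , won
  play-out {P} (suc n) {t} {p} s finishes with t ≟ᴾ P
  ... | no t≢P = awaiting t≢P s λ q s′ p⊑q →
    play-out n s′ λ f j completes → finishes f j λ k a → completes k a ∘ p⊑q k a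
  ... | yes t≡P = let k , open′ = #open-positive p (moves-left s) in
    choosing t≡P s k 1# (λ _ → 1≉0) open′ λ s′ p⊑q _ →
    play-out n s′ λ f j completes → finishes f j λ k a → completes k a ∘ p⊑q k a

-- Winning strategies, degree by degree.

module Strategies {c ℓ : Level} (K : Field c ℓ) (𝓥 : DiscreteValuation K) where
  open Field K hiding (zero)
  open DiscreteValuation 𝓥
  open Valued K 𝓥

  wanda-wins : ∀ {d} first → 0 < d → lastMover first d ≡ wanda → Game.HasWinningStrategy K d wanda first
  wanda-wins {d} first 0<d eq = play-out d (≡.subst (λ P → Turn P d first _) eq (start-turn first))
    λ f j _ ends → let a , a≉0 , won = wanda-finishes 0<d f j ends in a , (λ _ → a≉0) , won
    where
    open Playing K d
    open Polynomials d

  module _ {d : ℕ} where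
    open Playing K d using (Finishes)
    open Polynomials d

    -- When `j` is an end, only the opposite end imposes a condition, and its modulus is `d ≥ 2`.
    finish-end : 2 ℕ.≤ d → ∀ f j → IsEnd j → Finishes nora f j
    finish-end 2≤d f j end ends = let a , a≉0 , won = nora-finishes f j ends (choice end)
                                  in a , (λ _ → a≉0) , won
      where
      choice : IsEnd j → ∀ M → ∃[ T ] T ℤ.≤ M ×
        (zero ≢ j → ¬ + toℕ j ℤ.∣ T ℤ.- finite (V f zero)) ×
        (fromℕ d ≢ j → ¬ + (d ℕ.∸ toℕ j) ℤ.∣ T ℤ.- finite (V f (fromℕ d)))
      choice (inj₁ ≡.refl) M with avoid-one d 2≤d (finite (V f (fromℕ d))) M
      ... | T , T≤M , ∤ = T , T≤M , contradiction ≡.refl , λ _ → ∤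
      choice (inj₂ ≡.refl) M with avoid-one d 2≤d (finite (V f zero)) M
      ... | T , T≤M , ∤ = T , T≤M
        , (λ _ → ≡.subst (λ n → ¬ + n ℤ.∣ T ℤ.- finite (V f zero)) (≡.sym (Fin.toℕ-fromℕ d)) ∤) , contradiction ≡.refl

    -- The moduli `j` and `d - j` are at least 2 with sum at least 5, so one of them is at least 3,
    -- as `avoid-two` demands.
    finish-middle : 5 ℕ.≤ d → ∀ f j → 2 ℕ.≤ toℕ j → 2 ℕ.≤ d ℕ.∸ toℕ j → Finishes nora f j
    finish-middle 5≤d f j 2≤j 2≤d-j ends =
      let a , a≉0 , won = nora-finishes f j ends choice in a , (λ _ → a≉0) , won
      where
      α = finite (V f zero)
      δ = finite (V f (fromℕ d))
      choice : ∀ M → ∃[ T ] T ℤ.≤ M × (zero ≢ j → ¬ + toℕ j ℤ.∣ T ℤ.- α) ×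
                            (fromℕ d ≢ j → ¬ + (d ℕ.∸ toℕ j) ℤ.∣ T ℤ.- δ)
      choice M with 3 ℕ.≤? toℕ j
      ... | yes 3≤j = let T , T≤M , ∤α , ∤δ = avoid-two (toℕ j) (d ℕ.∸ toℕ j) 3≤j 2≤d-j α δ M
                      in T , T≤M , (λ _ → ∤α) , λ _ → ∤δ
      ... | no  3≰j = let T , T≤M , ∤δ , ∤α = avoid-two (d ℕ.∸ toℕ j) (toℕ j) 3≤d-j 2≤j δ α M
                      in T , T≤M , (λ _ → ∤α) , λ _ → ∤δ
        where
        3≤d-j : 3 ℕ.≤ d ℕ.∸ toℕ j
        3≤d-j = ℕ.∸-mono 5≤d (ℕ.≤-pred (ℕ.≰⇒> 3≰j))

    finish-inside : 5 ℕ.≤ d → ∀ f j → toℕ j ≢ 1 → suc (toℕ j) ≢ d → Finishes nora f j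
    finish-inside 5≤d f j j≢1 1+j≢d with zero Fin.≟ j | fromℕ d Fin.≟ j
    ... | yes ≡.refl | _          = finish-end (ℕ.≤-trans (s≤s (s≤s z≤n)) 5≤d) f j (inj₁ ≡.refl)
    ... | no _       | yes ≡.refl = finish-end (ℕ.≤-trans (s≤s (s≤s z≤n)) 5≤d) f j (inj₂ ≡.refl)
    ... | no 0≢j     | no d≢j     = finish-middle 5≤d f j 2≤j 2≤d-j
      where
      2≤j : 2 ℕ.≤ toℕ j
      2≤j = ℕ.≤∧≢⇒< (0<toℕ j (0≢j ∘ ≡.sym)) (j≢1 ∘ ≡.sym)
      2+j≤d : 2 ℕ.+ toℕ j ℕ.≤ d
      2+j≤d = ℕ.≤∧≢⇒< (ℕ.≤∧≢⇒< (Fin.toℕ≤pred[n] j)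
        λ eq → d≢j (Fin.toℕ-injective (≡.trans (Fin.toℕ-fromℕ d) (≡.sym eq)))) 1+j≢d
      2≤d-j : 2 ℕ.≤ d ℕ.∸ toℕ j
      2≤d-j = ≡.subst (ℕ._≤ d ℕ.∸ toℕ j) (ℕ.m+n∸n≡m 2 (toℕ j)) (ℕ.∸-monoˡ-≤ (toℕ j) 2+j≤d)

  -- Once `a₁` is filled, the last move can only be at an end.
  nora-wins-quadratic : ∀ first → lastMover first 2 ≡ nora → Game.HasWinningStrategy K 2 nora first
  nora-wins-quadratic first eq =
    fill 1F 1# (λ _ → 1≉0) 0 (≡.subst (λ P → Turn P 2 first _) eq (start-turn first))
      λ _ s _ (_ , p₁) → play-out _ s λ f j completes →
        finish-end ℕ.≤-refl f j (end j (proj₁ (completes 1F _ p₁)))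
    where
    open Playing K 2
    end : ∀ (j : Fin 3) → 1F ≢ j → IsEnd j
    end zero     _   = inj₁ ≡.refl
    end 1F       1≢1 = contradiction ≡.refl 1≢1
    end 2F       _   = inj₂ ≡.refl

  -- A very negative v(a₂) fails exactly when v(a₀) ≢ v(a₄) mod 2, but then a₂ = 0
  -- leaves a single edge of non-integral slope.
  finish-biquadratic : ∀ f → lookup f 1F ≡ 0# → lookup f 3F ≡ 0# → Playing.Finishes K 4 nora f 2F
  finish-biquadratic f@(a₀ ∷ a₁ ∷ a₂ ∷ a₃ ∷ a₄ ∷ []) a₁≡0 a₃≡0 ends
    with + 2 ℤ.∣? finite (v a₄) ℤ.- finite (v a₀)
  ... | no 2∤ = 0# , (λ { (inj₁ ()) ; (inj₂ ()) }) ,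
    binomial-no-root (f [ 2F ]≔ 0#) (ends zero (inj₁ ≡.refl) λ ()) (ends (fromℕ 4) (inj₂ ≡.refl) λ ())
      middle (2∤ ∘ ℤ.∣-trans (divides (+ 2) ≡.refl))
    where
    open Polynomials 4
    middle : ∀ k → ¬ IsEnd k → lookup (f [ 2F ]≔ 0#) k ≈ 0#
    middle zero                         mid = contradiction (inj₁ ≡.refl) mid
    middle 1F                           _   = reflexive a₁≡0
    middle 2F                           _   = refl
    middle 3F                           _   = reflexive a₃≡0
    middle (suc (suc (suc (suc zero)))) mid = contradiction (inj₂ ≡.refl) mid
  ... | yes 2∣ = let a , a≉0 , won = nora-finishes f 2F ends choice in a , (λ _ → a≉0) , won
    where
    open Polynomials 4
    α = finite (v a₀)
    δ = finite (v a₄)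
    add : ∀ t d a → (t ℤ.- d) ℤ.+ (d ℤ.- a) ≡ t ℤ.- a
    add = solve-∀
    choice : ∀ M → ∃[ T ] T ℤ.≤ M × (zero ≢ 2F → ¬ + 2 ℤ.∣ T ℤ.- α) ×
                          (fromℕ 4 ≢ 2F → ¬ + 2 ℤ.∣ T ℤ.- δ)
    -- Both moduli are 2 and the end values have the same parity, so avoiding the class of `α` also
    -- avoids that of `δ`.
    choice M with avoid-one 2 ℕ.≤-refl α M
    ... | T , T≤M , ∤α = T , T≤M , (λ _ → ∤α) , λ _ 2∣T-δ →
      ∤α (≡.subst (+ 2 ℤ.∣_) (add T δ α) (∣m∣n⇒∣m+n 2∣T-δ 2∣))

  -- With five moves Nora also starts, and she sets `a₁ = 0`. If Wanda answers at `a₃`, filling `a₂`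
  -- leaves an end for last; otherwise Nora sets `a₃ = 0`, and the last move is at an end or at
  -- `a₂`.
  nora-wins-quartic : ∀ first → lastMover first 4 ≡ nora → Game.HasWinningStrategy K 4 nora first
  nora-wins-quartic nora _ = choosing ≡.refl (start-turn nora) 1F 0# middle₁ ≡.refl
    λ s₁ _ p₁ → awaiting (λ ()) s₁ λ q s₂ p⊑q → respond q s₂ (p⊑q 1F 0# p₁) (filled? q 3F)
    where
    open Playing K 4
    middle₁ : IsEnd {4} 1F → ¬ 0# ≈ 0#
    middle₁ (inj₁ ())
    middle₁ (inj₂ ())
    middle₃ : IsEnd {4} 3F → ¬ 0# ≈ 0#
    middle₃ (inj₁ ())
    middle₃ (inj₂ ())
    respond : ∀ q → Turn nora 2 nora q → lookup q 1F ≡ just 0# →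
              Filled q 3F ⊎ lookup q 3F ≡ nothing → Wins nora nora q
    respond q s q₁ (inj₁ (a , q₃)) = fill 2F 1# (λ _ → 1≉0) 0 s
      λ _ s′ q⊑r (b , r₂) → play-out _ s′ λ f j completes →
        finish-end (s≤s (s≤s z≤n)) f j (end j (proj₁ (completes 1F 0# (q⊑r 1F 0# q₁)))
          (proj₁ (completes 2F b r₂)) (proj₁ (completes 3F a (q⊑r 3F a q₃))))
      where
      end : ∀ (j : Fin 5) → 1F ≢ j → 2F ≢ j → 3F ≢ j → IsEnd j
      end zero _   _   _   = inj₁ ≡.refl
      end 1F   1≢1 _   _   = contradiction ≡.refl 1≢1
      end 2F   _   2≢2 _   = contradiction ≡.refl 2≢2
      end 3F   _   _   3≢3 = contradiction ≡.refl 3≢3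
      end (suc (suc (suc (suc zero)))) _ _ _ = inj₂ ≡.refl
    respond q s q₁ (inj₂ open₃) = choosing ≡.refl s 3F 0# middle₃ open₃ λ s′ q⊑r r₃ →
      play-out _ s′ λ f j completes →
        finish f j (completes 1F 0# (q⊑r 1F 0# q₁)) (completes 3F 0# r₃)
      where
      finish : ∀ f j → 1F ≢ j × lookup f 1F ≡ 0# → 3F ≢ j × lookup f 3F ≡ 0# → Finishes nora f j
      finish f zero _          _          = finish-end (s≤s (s≤s z≤n)) f zero (inj₁ ≡.refl)
      finish f 1F   (1≢1 , _)  _          = contradiction ≡.refl 1≢1
      finish f 2F   (_ , f₁≡0) (_ , f₃≡0) = finish-biquadratic f f₁≡0 f₃≡0
      finish f 3F   _          (3≢3 , _)  = contradiction ≡.refl 3≢3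
      finish f (suc (suc (suc (suc zero)))) _ _ =
        finish-end (s≤s (s≤s z≤n)) f (fromℕ 4) (inj₂ ≡.refl)

  -- Filling the coefficients 1 and `D - 1` costs at most four of the at least six moves, so the
  -- last move is still to come and falls elsewhere.
  nora-wins-high-degree : ∀ d first → lastMover first (5 ℕ.+ d) ≡ nora →
                          Game.HasWinningStrategy K (5 ℕ.+ d) nora first
  nora-wins-high-degree d first eq =
    fill 1F 1# (λ _ → 1≉0) (3 ℕ.+ d) (≡.subst (λ P → Turn P D first _) eq (start-turn first)) second
    where
    D = 5 ℕ.+ d
    open Game K D using (start)
    open Playing K D
    last-but-one : Fin (suc D)
    last-but-one = inject₁ (fromℕ (4 ℕ.+ d))
    second : ∀ {n t p} → 3 ℕ.+ d ℕ.≤ n → Turn nora n t p → start ⊑ p → Filled p 1F → Wins nora t p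
    second {suc zero} (s≤s ())
    second {suc (suc n)} _ s _ (a , p₁) = fill last-but-one 1# (λ _ → 1≉0) n s
      λ _ s′ p⊑q (b , q₋) → play-out _ s′ λ f j completes →
        finish-inside (ℕ.m≤m+n 5 d) f j
          (λ j≡1 → proj₁ (completes 1F a (p⊑q 1F a p₁)) (Fin.toℕ-injective (≡.sym j≡1)))
          (λ 1+j≡D → proj₁ (completes last-but-one b q₋) (Fin.toℕ-injective (≡.trans
            (≡.trans (Fin.toℕ-inject₁ (fromℕ (4 ℕ.+ d))) (Fin.toℕ-fromℕ (4 ℕ.+ d)))
            (ℕ.suc-injective (≡.sym 1+j≡D)))))

  -- With four moves Wanda starts. If she takes `a₁`, filling `a₂` leaves an end for last; otherwise
  -- Nora sets `a₁ = 0`, and a last move at `a₂` falls to `rootless-cubic`.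
  nora-wins-cubic : ResidueSystem K 𝓥 → ∀ first → lastMover first 3 ≡ nora →
                    Game.HasWinningStrategy K 3 nora first
  nora-wins-cubic residues wanda _ = awaiting (λ ()) (start-turn wanda)
    λ q s _ → respond q s (filled? q 1F)
    where
    open Playing K 3
    open Cubic K 𝓥 residues using (rootless-cubic)
    middle₁ : IsEnd {3} 1F → ¬ 0# ≈ 0#
    middle₁ (inj₁ ())
    middle₁ (inj₂ ())
    respond : ∀ q → Turn nora 2 nora q → Filled q 1F ⊎ lookup q 1F ≡ nothing → Wins nora nora q
    respond q s (inj₁ (a , q₁)) = fill 2F 1# (λ _ → 1≉0) 0 s
      λ _ s′ q⊑r (b , r₂) → play-out _ s′ λ f j completes →
        finish-end (s≤s (s≤s z≤n)) f j (end j (proj₁ (completes 1F a (q⊑r 1F a q₁)))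
          (proj₁ (completes 2F b r₂)))
      where
      end : ∀ (j : Fin 4) → 1F ≢ j → 2F ≢ j → IsEnd j
      end zero _   _   = inj₁ ≡.refl
      end 1F   1≢1 _   = contradiction ≡.refl 1≢1
      end 2F   _   2≢2 = contradiction ≡.refl 2≢2
      end 3F   _   _   = inj₂ ≡.refl
    respond q s (inj₂ open₁) = choosing ≡.refl s 1F 0# middle₁ open₁ λ s′ _ r₁ →
      play-out _ s′ λ f j completes → finish f j (completes 1F 0# r₁)
      where
      finish : ∀ f j → 1F ≢ j × lookup f 1F ≡ 0# → Finishes nora f j
      finish f zero _         = finish-end (s≤s (s≤s z≤n)) f zero (inj₁ ≡.refl)
      finish f 1F   (1≢1 , _) = contradiction ≡.refl 1≢1
      finish f 2F   (_ , f₁≡0) ends =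
        let a , won = rootless-cubic f (ends zero (inj₁ ≡.refl) λ ())
                        (ends 3F (inj₂ ≡.refl) λ ()) (reflexive f₁≡0)
        in a , (λ { (inj₁ ()) ; (inj₂ ()) }) , won
      finish f 3F   _         = finish-end (s≤s (s≤s z≤n)) f 3F (inj₂ ≡.refl)

  last-mover-wins : ResidueSystem K 𝓥 → ∀ d → 1 < d → ∀ first →
                    Game.HasWinningStrategy K d (lastMover first d) first
  last-mover-wins residues d 1<d first with lastMover first d in eq
  ... | wanda = wanda-wins first (ℕ.<-trans (s≤s z≤n) 1<d) eq
  ... | nora  = nora-wins d 1<d first eq
    where
    nora-wins : ∀ d → 1 < d → ∀ first → lastMover first d ≡ nora → Game.HasWinningStrategy K d nora first
    nora-wins 1 (s≤s ())
    nora-wins 2 _ = nora-wins-quadratic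
    nora-wins 3 _ = nora-wins-cubic residues
    nora-wins 4 _ = nora-wins-quartic
    nora-wins (suc (suc (suc (suc (suc d))))) _ = nora-wins-high-degree d

theorem3 : {c ℓ c′ ℓ′ : Level} (O : CommutativeRing c ℓ) (K : Field c′ ℓ′)
    (ι : CommutativeRing.Carrier O → Field.Carrier K)
    (frac : IsFractionField O K ι) (dvr : IsDiscreteValuationRing frac) →
    IsComplete dvr → HasFiniteResidueField dvr →
    (d : ℕ) → 1 < d → (first : Player) →
    Game.HasWinningStrategy K d (lastMover first d) first
theorem3 O K ι frac dvr _ finite-residue-field =
  Strategies.last-mover-wins K (IsDiscreteValuationRing.discreteValuation dvr)
    (residue-system dvr finite-residue-field)
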